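{- Let $(S,d)$ be a symmetric $k$-center instance satisfying $(3,\epsilon)$-perturbation resilience, with optimal clustering $\mathcal{OPT}=\{C_1,\dots,C_k\}$ and optimal cost $r^*$, such that $|C_i|>\max(2\epsilon n,3)$ for all $i$. Then the clusters of $\mathcal{OPT}$ are exactly the connected components of the threshold graph $G_{r^*}$, the graph on vertex set $S$ with an edge between $p\ne q$ whenever $d(p,q)\le r^*$.
   Context: A symmetric $k$-center instance $(S,d)$ consists of a finite set $S$ of $n$ points, an integer $k$, and a metric $d$ on $S$. For a set of $k$ distinct centers, the cost is $\max_{p\in S}\min_i d(c_i,p)$ and the Voronoi partition assigns each point to a closest center. $\mathcal{OPT}$ is the Voronoi partition of an optimal set of centers and $r^*$ the optimal cost. An $\alpha$-perturbation of $d$ is any $d':S\times S\to\mathbb{R}_{\ge0}$ (not required to be a metric) with $d(p,q)\le d'(p,q)\le\alpha d(p,q)$ for all $p,q$. Clusterings $\mathcal{C},\mathcal{C}'$ are $\epsilon$-close if $\min_\sigma\sum_{i=1}^k|C_i\setminus C'_{\sigma(i)}|\le\epsilon n$ over permutations $\sigma$ of $[k]$. The instance satisfies $(\alpha,\epsilon)$-perturbation resilience if for every $\alpha$-perturbation $d'$ of $d$, every optimal $k$-center clustering under $d'$ (the Voronoi partition under $d'$ of a set of $k$ distinct centers of minimum cost under $d'$) is $\epsilon$-close to $\mathcal{OPT}$.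
   Formalization: The distances d and the parameter ε are taken rational instead of real (so r* is rational too), and resilience is only required for rational-valued perturbations d'. -}

module Defs where

open import Data.Nat as ℕ using (ℕ)
open import Data.Integer using (+_)
open import Data.Rational using (ℚ; _/_; _≤_; _<_; _*_; _+_; 0ℚ)
open import Data.Fin using (Fin; _≟_)
open import Data.Fin.Permutation using (Permutation′; _⟨$⟩ʳ_)
open import Data.List using (List; length; filter; allFin; map)
open import Data.Nat.ListAction using (sum)
open import Data.Product using (Σ; ∃; ∃-syntax; _×_; _,_; proj₁)
open import Relation.Binary.PropositionalEquality using (_≡_; _≢_)
open import Relation.Nullary using (¬_)
open import Relation.Nullary.Decidable using (_×-dec_; ¬?)
open import Relation.Binary.Construct.Closure.ReflexiveTransitive using (Star)
open import Function.Definitions using (Injective)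

ℕ→ℚ : ℕ → ℚ
ℕ→ℚ m = + m / 1

Dist : ℕ → Set
Dist n = Fin n → Fin n → ℚ

record IsMetric {n : ℕ} (d : Dist n) : Set where
  field
    nonneg   : ∀ p q → 0ℚ ≤ d p q
    zero-iff : ∀ p q → (d p q ≡ 0ℚ → p ≡ q) × (p ≡ q → d p q ≡ 0ℚ)
    symm     : ∀ p q → d p q ≡ d q p
    triangle : ∀ p q r → d p r ≤ d p q + d q r

Centers : ℕ → ℕ → Set
Centers n k = Σ (Fin k → Fin n) (Injective _≡_ _≡_)

-- cost(c) = max_p min_i D(c_i, p)
CostAtMost : {n k : ℕ} → Dist n → (Fin k → Fin n) → ℚ → Set
CostAtMost D c r = ∀ p → ∃[ i ] D (c i) p ≤ r

CostAtLeast : {n k : ℕ} → Dist n → (Fin k → Fin n) → ℚ → Set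
CostAtLeast D c r = ∃[ p ] (∀ i → r ≤ D (c i) p)

CostIs : {n k : ℕ} → Dist n → (Fin k → Fin n) → ℚ → Set
CostIs D c r = CostAtMost D c r × CostAtLeast D c r

OptimalWithCost : {n k : ℕ} → Dist n → Centers n k → ℚ → Set
OptimalWithCost {n} {k} D c r =
  CostIs D (proj₁ c) r × (∀ (c′ : Centers n k) → CostAtLeast D (proj₁ c′) r)

Optimal : {n k : ℕ} → Dist n → Centers n k → Set
Optimal D c = ∃[ r ] OptimalWithCost D c r

Clustering : ℕ → ℕ → Set
Clustering n k = Fin n → Fin k

-- a is a Voronoi partition of the centers c under D (ties broken arbitrarily)
IsVoronoi : {n k : ℕ} → Dist n → (Fin k → Fin n) → Clustering n k → Set
IsVoronoi D c a = ∀ p i → D (c (a p)) p ≤ D (c i) p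

clusterSize : {n k : ℕ} → Clustering n k → Fin k → ℕ
clusterSize {n} a i = length (filter (λ p → a p ≟ i) (allFin n))

diffSize : {n k : ℕ} → Clustering n k → Clustering n k → Fin k → Fin k → ℕ
diffSize {n} a a′ i j = length (filter (λ p → (a p ≟ i) ×-dec ¬? (a′ p ≟ j)) (allFin n))

-- ε-close: min_σ Σ_i |C_i \ C'_{σ i}| ≤ ε n
EpsClose : {n k : ℕ} → ℚ → Clustering n k → Clustering n k → Set
EpsClose {n} {k} ε a a′ =
  Σ (Permutation′ k) λ σ → ℕ→ℚ (sum (map (λ i → diffSize a a′ i (σ ⟨$⟩ʳ i)) (allFin k))) ≤ ε * ℕ→ℚ n

IsPerturbation : {n : ℕ} → ℚ → Dist n → Dist n → Set
IsPerturbation α d d′ = ∀ p q → (d p q ≤ d′ p q) × (d′ p q ≤ α * d p q)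

-- (α, ε)-perturbation resilience relative to the optimal clustering a
PerturbationResilient : {n k : ℕ} → ℚ → ℚ → Dist n → Clustering n k → Set
PerturbationResilient {n} {k} α ε d a =
  ∀ (d′ : Dist n) → IsPerturbation α d d′ →
  ∀ (c′ : Centers n k) → Optimal d′ c′ →
  ∀ (a′ : Clustering n k) → IsVoronoi d′ (proj₁ c′) a′ →
  EpsClose ε a a′

ThresholdEdge : {n : ℕ} → Dist n → ℚ → Fin n → Fin n → Set
ThresholdEdge d r p q = (p ≢ q) × (d p q ≤ r)

SameComponent : {n : ℕ} → Dist n → ℚ → Fin n → Fin n → Set
SameComponent d r = Star (ThresholdEdge d r)

{-# OPTIONS --safe #-}
module Submission where

-- Any k points that cover S within 3r* are optimal for every perturbation lifting all distances
-- ≥ r* to at least 3r*.  Tripling the distances of some centers where that hurts them most,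
-- resilience still lets each of the k points win most of one cluster, beating every other center
-- by a factor 3 there.
-- Suppose an edge of the threshold graph joins two clusters A and D.  Replacing the centers of A
-- and D by two points x, y of A ∪ D, x being incident to such an edge, again covers S within 3r*.
-- For a suitable choice of A and D all other centers keep their own clusters, so one of x, y wins
-- A and the other wins D: this orders the points of A ∪ D almost like a tournament.
-- Take a closest pair of points incident to such edges that are neither first nor last, x winning A
-- and y winning D, and let y win A against z, and z′ win A against x.  A point of A won by x from y
-- and by y from z is closer to x than d x y / 2, so it is x itself or z′; likewise in D.  Counting
-- the points not won then contradicts the cluster sizes.

open import Defs
open import Level using (0ℓ)
open import Data.Empty using (⊥; ⊥-elim)
open import Data.Fin as Fin using (Fin; _≟_)
open import Data.Fin.Permutation using (Permutation′; _⟨$⟩ʳ_; _⟨$⟩ˡ_; inverseˡ; inverseʳ)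
import Data.Fin.Properties as Finₚ
open import Data.Fin.Properties using (any?; all?)
open import Data.Integer as ℤ using (+_)
import Data.Integer.Properties as ℤₚ
open import Data.List using (List; []; _∷_; length; filter; allFin; map; cartesianProduct)
open import Data.List.Membership.Propositional using (_∈_)
open import Data.List.Membership.Propositional.Properties
  using (∈-allFin; ∈-filter⁺; ∈-filter⁻; ∈-cartesianProduct⁺)
open import Data.List.Relation.Unary.All using (_∷_)
open import Data.List.Relation.Unary.AllPairs using (_∷_)
open import Data.List.Relation.Unary.Any using (here; there)
open import Data.List.Relation.Unary.Unique.Propositional using (Unique)
open import Data.List.Relation.Unary.Unique.Propositional.Properties using (allFin⁺)
  renaming (filter⁺ to unique-filter⁺)
open import Data.Nat as ℕ using (ℕ; zero; suc; s≤s; z≤n)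
open import Data.Nat.ListAction using (sum)
import Data.Nat.Properties as ℕₚ
import Data.Nat.Solver as ℕSolver
open import Data.Product using (∃; _×_; _,_; proj₁; proj₂)
open import Data.Rational using (ℚ; _<_; _≤_; _*_; _+_; 0ℚ; _⊔_; _<?_; _≤?_; toℚᵘ)
open import Data.Rational.Properties hiding (_≟_; _<?_; _≤?_)
import Data.Rational.Unnormalised as ℚᵘ
import Data.Rational.Unnormalised.Properties as ℚᵘₚ
open import Data.Sum using (_⊎_; inj₁; inj₂; [_,_]′)
open import Function using (_∘_; id)
open import Function.Bundles using (_⇔_; mk⇔)
open import Function.Definitions using (Injective)
open import Relation.Binary.Construct.Closure.ReflexiveTransitive as Star using (_◅_; _◅◅_)
open import Relation.Binary.PropositionalEquality
  using (_≡_; _≢_; refl; sym; trans; cong; cong₂; subst; subst₂)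
open import Relation.Nullary using (¬_; Dec; yes; no)
open import Relation.Nullary.Decidable using (_×-dec_; _→-dec_; ¬?; decidable-stable)
open import Relation.Nullary.Negation using (contradiction)
open import Relation.Unary using (Pred; Decidable)

-- Counting

count : ∀ {n} {P : Pred (Fin n) 0ℓ} → Decidable P → ℕ
count {n} P? = length (filter P? (allFin n))

module _ {A : Set} {P Q R : Pred A 0ℓ} (P? : Decidable P) (Q? : Decidable Q) (R? : Decidable R) where

  length-filter-⊎ : (∀ x → P x → Q x ⊎ R x) → ∀ xs →
    length (filter P? xs) ℕ.≤ length (filter Q? xs) ℕ.+ length (filter R? xs)
  length-filter-⊎ h [] = z≤n
  length-filter-⊎ h (x ∷ xs) with ih ← length-filter-⊎ h xs | P? x | Q? x | R? x
  ... | no _  | no _  | no _  = ih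
  ... | no _  | no _  | yes _ = ℕₚ.≤-trans ih (ℕₚ.+-monoʳ-≤ _ (ℕₚ.n≤1+n _))
  ... | no _  | yes _ | no _  = ℕₚ.m≤n⇒m≤1+n ih
  ... | no _  | yes _ | yes _ = ℕₚ.m≤n⇒m≤1+n (ℕₚ.≤-trans ih (ℕₚ.+-monoʳ-≤ _ (ℕₚ.n≤1+n _)))
  ... | yes _ | yes _ | no _  = s≤s ih
  ... | yes _ | yes _ | yes _ = s≤s (ℕₚ.≤-trans ih (ℕₚ.+-monoʳ-≤ _ (ℕₚ.n≤1+n _)))
  ... | yes _ | no _  | yes _ = subst (suc (length (filter P? xs)) ℕ.≤_) (sym (ℕₚ.+-suc _ _)) (s≤s ih)
  ... | yes p | no ¬q | no ¬r = ⊥-elim ([ ¬q , ¬r ]′ (h x p))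

module _ {n} {P Q R : Pred (Fin n) 0ℓ} (P? : Decidable P) (Q? : Decidable Q) (R? : Decidable R) where

  count-⊎ : (∀ x → P x → Q x ⊎ R x) → count P? ℕ.≤ count Q? ℕ.+ count R?
  count-⊎ h = length-filter-⊎ P? Q? R? h (allFin n)

module _ {n} {P : Pred (Fin n) 0ℓ} (P? : Decidable P) where

  count-none : (∀ x → ¬ P x) → count P? ≡ 0
  count-none h = go (allFin n)
    where
    go : ∀ xs → length (filter P? xs) ≡ 0
    go [] = refl
    go (x ∷ xs) with P? x
    ... | yes p = ⊥-elim (h x p)
    ... | no _  = go xs

  count-unique : ∀ y → (∀ x → P x → x ≡ y) → count P? ℕ.≤ 1
  count-unique y h = go (filter P? (allFin n)) (unique-filter⁺ P? (allFin⁺ n))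
                        (λ x∈ → h _ (proj₂ (∈-filter⁻ P? {xs = allFin n} x∈)))
    where
    go : ∀ xs → Unique xs → (∀ {x} → x ∈ xs → x ≡ y) → length xs ℕ.≤ 1
    go []           _               _ = z≤n
    go (_ ∷ [])     _               _ = s≤s z≤n
    go (x ∷ z ∷ _) ((x≢z ∷ _) ∷ _) e =
      ⊥-elim (x≢z (trans (e (here refl)) (sym (e (there (here refl))))))

  count-pos : ∀ x → P x → 1 ℕ.≤ count P?
  count-pos x p with filter P? (allFin n) | ∈-filter⁺ P? (∈-allFin x) p
  ... | _ ∷ _ | _ = s≤s z≤n

module _ {n} {P Q : Pred (Fin n) 0ℓ} (P? : Decidable P) (Q? : Decidable Q) where

  count-mono : (∀ x → P x → Q x) → count P? ℕ.≤ count Q?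
  count-mono h = begin
    count P?                    ≤⟨ count-⊎ P? Q? none? (λ x p → inj₁ (h x p)) ⟩
    count Q? ℕ.+ count none?    ≡⟨ cong (count Q? ℕ.+_) (count-none none? (λ _ ())) ⟩
    count Q? ℕ.+ 0              ≡⟨ ℕₚ.+-identityʳ _ ⟩
    count Q?                    ∎
    where
    open ℕₚ.≤-Reasoning
    none? : Decidable {A = Fin n} (λ _ → ⊥)
    none? _ = no λ ()

  -- Either `y` satisfies `P`, which leaves `Q` empty, or `P` itself is empty.
  count-exclusive : ∀ y z → (∀ x → P x → x ≡ y) → (∀ x → Q x → x ≡ z) →
    (∀ {u v} → P u → Q v → ⊥) → count P? ℕ.+ count Q? ℕ.≤ 1
  count-exclusive y z P⊆y Q⊆z excl with P? y
  ... | yes p = begin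
    count P? ℕ.+ count Q?   ≡⟨ cong (count P? ℕ.+_) (count-none Q? (λ _ → excl p)) ⟩
    count P? ℕ.+ 0          ≡⟨ ℕₚ.+-identityʳ _ ⟩
    count P?                ≤⟨ count-unique P? y P⊆y ⟩
    1                       ∎
    where open ℕₚ.≤-Reasoning
  ... | no ¬p = begin
    count P? ℕ.+ count Q?   ≡⟨ cong (ℕ._+ count Q?) (count-none P? (λ x p → ¬p (subst P (P⊆y x p) p))) ⟩
    count Q?                ≤⟨ count-unique Q? z Q⊆z ⟩
    1                       ∎
    where open ℕₚ.≤-Reasoning

module _ {A : Set} (f : A → ℕ) where

  ≤-sum-map : ∀ {x xs} → x ∈ xs → f x ℕ.≤ sum (map f xs)
  ≤-sum-map (here refl) = ℕₚ.m≤m+n _ _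
  ≤-sum-map (there x∈)  = ℕₚ.≤-trans (≤-sum-map x∈) (ℕₚ.m≤n+m _ _)

  +-≤-sum-map : ∀ {x y xs} → x ≢ y → x ∈ xs → y ∈ xs → f x ℕ.+ f y ℕ.≤ sum (map f xs)
  +-≤-sum-map x≢y (here refl) (here refl) = ⊥-elim (x≢y refl)
  +-≤-sum-map x≢y (here refl) (there y∈)  = ℕₚ.+-monoʳ-≤ _ (≤-sum-map y∈)
  +-≤-sum-map {x} {y} {_ ∷ xs} x≢y (there x∈) (here refl) =
    subst (ℕ._≤ f y ℕ.+ sum (map f xs)) (ℕₚ.+-comm (f y) (f x)) (ℕₚ.+-monoʳ-≤ (f y) (≤-sum-map x∈))
  +-≤-sum-map x≢y (there x∈) (there y∈) = ℕₚ.≤-trans (+-≤-sum-map x≢y x∈ y∈) (ℕₚ.m≤n+m _ _)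

sum-map-mono : ∀ {A : Set} {f g : A → ℕ} → (∀ x → f x ℕ.≤ g x) → ∀ xs → sum (map f xs) ℕ.≤ sum (map g xs)
sum-map-mono f≤g []       = z≤n
sum-map-mono f≤g (x ∷ xs) = ℕₚ.+-mono-≤ (f≤g x) (sum-map-mono f≤g xs)

-- Minima, the pigeonhole principle and undecidable choices

argmin : ∀ {k} → Fin k → (f : Fin k → ℚ) → ∃ λ i → ∀ j → f i ≤ f j
argmin {suc zero} _ f = Fin.zero , λ { Fin.zero → ≤-refl }
argmin {suc (suc k)} _ f with argmin {suc k} Fin.zero (f ∘ Fin.suc)
... | i , min with f Fin.zero ≤? f (Fin.suc i)
... | yes p = Fin.zero , λ { Fin.zero → ≤-refl ; (Fin.suc j) → ≤-trans p (min j) }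
... | no ¬p = Fin.suc i , λ { Fin.zero → <⇒≤ (≰⇒> ¬p) ; (Fin.suc j) → min j }

-- A missed value `j` could be punched out, leaving an injection of `suc k` elements into `k`.
injective⇒surjective : ∀ {k} (f : Fin k → Fin k) → Injective _≡_ _≡_ f → ∀ j → ∃ λ i → f i ≡ j
injective⇒surjective {suc k} f inj j = decidable-stable (any? (λ i → f i ≟ j)) λ miss →
  let away : ∀ i → j ≢ f i
      away i e = miss (i , sym e)
      i , i′ , i<i′ , e = Finₚ.pigeonhole ℕₚ.≤-refl (λ i → Fin.punchOut (away i))
  in Finₚ.<⇒≢ i<i′ (inj (Finₚ.punchOut-injective (away i) (away i′) e))

-- Only a refutation is ever needed, so the predicate may be undecidable.
classical-minimum : ∀ {A : Set} (P : A → Set) (f : A → ℚ) (xs : List A) →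
  (∀ x → x ∈ xs → P x → (∀ y → y ∈ xs → P y → f x ≤ f y) → ⊥) → ∀ x → x ∈ xs → ¬ P x
classical-minimum P f (w ∷ ws) h = none
  where
  not-in-tail : ∀ x → x ∈ ws → ¬ P x
  not-in-tail = classical-minimum P f ws λ x x∈ px min →
    let ¬pw≤ : ¬ (P w × f w ≤ f x)
        ¬pw≤ (pw , w≤x) = h w (here refl) pw λ
          { y (here refl) _  → ≤-refl
          ; y (there y∈)  py → ≤-trans w≤x (min y y∈ py) }
    in h x (there x∈) px λ
      { y (here refl) pw → <⇒≤ (≰⇒> (λ w≤x → ¬pw≤ (pw , w≤x)))
      ; y (there y∈)  py → min y y∈ py }
  none : ∀ x → x ∈ w ∷ ws → ¬ P x
  none x (there x∈)  p = not-in-tail x x∈ p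
  none x (here refl) p = h x (here refl) p λ
    { y (here refl) _  → ≤-refl
    ; y (there y∈)  py → ⊥-elim (not-in-tail y y∈ py) }

module _ {X : Set} where

  -- `P` fails at most once on `K` but need not be decidable, so `P a` is shown neither to fail nor
  -- to hold: failing leaves `b` and `c` as the pair, holding makes both of these fail and hence
  -- coincide.
  two-of-three : ∀ {K P : X → Set} → (∀ {u v} → K u → K v → ¬ P u → ¬ P v → u ≡ v) →
    ∀ {a b c} → K a → K b → K c → a ≢ b → a ≢ c → b ≢ c →
    (∀ {u v} → K u → K v → u ≢ v → P u → P v → ⊥) → ⊥
  two-of-three {K} {P} uniq {a} {b} {c} ka kb kc a≢b a≢c b≢c found = ¬¬pa ¬pa
    where
    ¬¬pa : ¬ ¬ P a
    ¬¬pa na = pb λ b → pc λ c → found kb kc b≢c b c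
      where
      pb : ¬ ¬ P b
      pb nb = a≢b (uniq ka kb na nb)
      pc : ¬ ¬ P c
      pc nc = a≢c (uniq ka kc na nc)
    ¬pa : ¬ P a
    ¬pa pa = b≢c (uniq kb kc (found ka kb a≢b pa) (found ka kc a≢c pa))

  -- If `P a` holds, two of the other points complete it to a triple: this is `two-of-three` on the
  -- points distinct from `a`.
  three-of-four : ∀ {K P : X → Set} → (∀ {u v} → K u → K v → ¬ P u → ¬ P v → u ≡ v) →
    ∀ {a b c d} → K a → K b → K c → K d → a ≢ b → a ≢ c → a ≢ d → b ≢ c → b ≢ d → c ≢ d →
    (∀ {u v w} → K u → K v → K w → u ≢ v → u ≢ w → v ≢ w → P u → P v → P w → ⊥) → ⊥
  three-of-four {K} {P} uniq {a} {b} {c} {d} ka kb kc kd a≢b a≢c a≢d b≢c b≢d c≢d found = ¬¬pa ¬pa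
    where
    ¬¬pa : ¬ ¬ P a
    ¬¬pa na = (λ nb → a≢b (uniq ka kb na nb)) λ pb →
              (λ nc → a≢c (uniq ka kc na nc)) λ pc →
              (λ nd → a≢d (uniq ka kd na nd)) λ pd → found kb kc kd b≢c b≢d c≢d pb pc pd
    ¬pa : ¬ P a
    ¬pa pa = two-of-three {K = λ u → K u × a ≢ u} {P = P}
      (λ (ku , _) (kv , _) → uniq ku kv) (kb , a≢b) (kc , a≢c) (kd , a≢d) b≢c b≢d c≢d
      (λ (ku , a≢u) (kv , a≢v) u≢v pu pv → found ka ku kv a≢u a≢v u≢v pa pu pv)

-- Natural number arithmetic

-- The unit in `g` pays for `e`, so that `size ≤ f + g + s ≤ 2s`.
one-sided : ∀ {s size} f f′ g e → s ℕ.+ s ℕ.< size → size ℕ.≤ f ℕ.+ (f′ ℕ.+ e) →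
  f ℕ.+ g ℕ.≤ s → f′ ℕ.≤ s → 1 ℕ.≤ g → e ℕ.≤ 1 → ⊥
one-sided {s} {size} f f′ g e 2s<size size≤ fg≤s f′≤s 1≤g e≤1 = ℕₚ.<⇒≱ 2s<size (begin
  size                ≤⟨ size≤ ⟩
  f ℕ.+ (f′ ℕ.+ e)    ≤⟨ ℕₚ.+-monoʳ-≤ f (ℕₚ.+-mono-≤ f′≤s (ℕₚ.≤-trans e≤1 1≤g)) ⟩
  f ℕ.+ (s ℕ.+ g)     ≡⟨ cong (f ℕ.+_) (ℕₚ.+-comm s g) ⟩
  f ℕ.+ (g ℕ.+ s)     ≡⟨ ℕₚ.+-assoc f g s ⟨
  (f ℕ.+ g) ℕ.+ s     ≤⟨ ℕₚ.+-monoˡ-≤ s fg≤s ⟩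
  s ℕ.+ s             ∎)
  where open ℕₚ.≤-Reasoning

-- The total size is at most 3s + 2, which forces s < 2 as it exceeds 4s,
-- and s ≥ 2 as it is at least 8.
two-sided : ∀ {s sizeA sizeD} f g f′ g′ p₁ p₂ q₁ q₂ →
  s ℕ.+ s ℕ.< sizeA → s ℕ.+ s ℕ.< sizeD → 4 ℕ.≤ sizeA → 4 ℕ.≤ sizeD →
  f ℕ.+ g ℕ.≤ s → f′ ℕ.≤ s → g′ ℕ.≤ s →
  sizeA ℕ.≤ f ℕ.+ (f′ ℕ.+ (p₁ ℕ.+ p₂)) → sizeD ℕ.≤ g ℕ.+ (g′ ℕ.+ (q₁ ℕ.+ q₂)) →
  p₁ ℕ.+ q₂ ℕ.≤ 1 → p₂ ℕ.+ q₁ ℕ.≤ 1 → ⊥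
two-sided {s} {sizeA} {sizeD} f g f′ g′ p₁ p₂ q₁ q₂ 2s<A 2s<D 4≤A 4≤D fg f′≤ g′≤ A≤ D≤ pq pq′ =
  ℕₚ.<⇒≱ s<2 2≤s
  where
  open ℕₚ.≤-Reasoning
  open ℕSolver.+-*-Solver
  3s = s ℕ.+ (s ℕ.+ s)
  total : sizeA ℕ.+ sizeD ℕ.≤ 3s ℕ.+ 2
  total = begin
    sizeA ℕ.+ sizeD
      ≤⟨ ℕₚ.+-mono-≤ A≤ D≤ ⟩
    (f ℕ.+ (f′ ℕ.+ (p₁ ℕ.+ p₂))) ℕ.+ (g ℕ.+ (g′ ℕ.+ (q₁ ℕ.+ q₂)))
      ≡⟨ solve 8 (λ f g f′ g′ p₁ p₂ q₁ q₂ →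
           (f :+ (f′ :+ (p₁ :+ p₂))) :+ (g :+ (g′ :+ (q₁ :+ q₂))) :=
           ((f :+ g) :+ (f′ :+ g′)) :+ ((p₁ :+ q₂) :+ (p₂ :+ q₁)))
           refl f g f′ g′ p₁ p₂ q₁ q₂ ⟩
    ((f ℕ.+ g) ℕ.+ (f′ ℕ.+ g′)) ℕ.+ ((p₁ ℕ.+ q₂) ℕ.+ (p₂ ℕ.+ q₁))
      ≤⟨ ℕₚ.+-mono-≤ (ℕₚ.+-mono-≤ fg (ℕₚ.+-mono-≤ f′≤ g′≤)) (ℕₚ.+-mono-≤ pq pq′) ⟩
    3s ℕ.+ 2 ∎
  s<2 : s ℕ.< 2
  s<2 = ℕₚ.+-cancelˡ-≤ 3s (suc s) 2 (begin
    3s ℕ.+ suc s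
      ≤⟨ ℕₚ.n≤1+n _ ⟩
    suc (3s ℕ.+ suc s)
      ≡⟨ solve 1 (λ s → con 1 :+ (s :+ (s :+ s) :+ (con 1 :+ s)) := (con 1 :+ (s :+ s)) :+ (con 1 :+ (s :+ s))) refl s ⟩
    suc (s ℕ.+ s) ℕ.+ suc (s ℕ.+ s)
      ≤⟨ ℕₚ.+-mono-≤ 2s<A 2s<D ⟩
    sizeA ℕ.+ sizeD
      ≤⟨ total ⟩
    3s ℕ.+ 2 ∎)
  2≤s : 2 ℕ.≤ s
  2≤s = ℕₚ.≮⇒≥ λ s<2 → let s≤1 = ℕₚ.≤-pred s<2 in ℕₚ.<⇒≱ {5} {8} (ℕₚ.m≤m+n 6 2) (begin
    8                    ≤⟨ ℕₚ.+-mono-≤ 4≤A 4≤D ⟩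
    sizeA ℕ.+ sizeD      ≤⟨ total ⟩
    3s ℕ.+ 2             ≤⟨ ℕₚ.+-monoˡ-≤ 2 (ℕₚ.+-mono-≤ s≤1 (ℕₚ.+-mono-≤ s≤1 s≤1)) ⟩
    5                    ∎)

-- Rational arithmetic

triple : ℚ → ℚ
triple t = t + t + t

triple-mono : ∀ {t u} → t ≤ u → triple t ≤ triple u
triple-mono t≤u = +-mono-≤ (+-mono-≤ t≤u t≤u) t≤u

≤-double : ∀ {t} → 0ℚ ≤ t → t ≤ t + t
≤-double {t} 0≤t = subst (_≤ t + t) (+-identityˡ t) (+-monoˡ-≤ t 0≤t)

double≤triple : ∀ {t} → 0ℚ ≤ t → t + t ≤ triple t
double≤triple {t} 0≤t = subst (_≤ triple t) (+-identityʳ (t + t)) (+-monoʳ-≤ (t + t) 0≤t)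

≤-triple : ∀ {t} → 0ℚ ≤ t → t ≤ triple t
≤-triple 0≤t = ≤-trans (≤-double 0≤t) (double≤triple 0≤t)

double-cancel : ∀ {x y z} → triple x < y → y ≤ z + x → x + x < z
double-cancel {x} {y} {z} 3x<y y≤z+x with x + x <? z
... | yes p = p
... | no ¬p = ⊥-elim (<-irrefl refl (<-≤-trans 3x<y (≤-trans y≤z+x (+-monoˡ-≤ x (≮⇒≥ ¬p)))))

double<⇒< : ∀ {x y} → 0ℚ ≤ x → x + x < y → x < y
double<⇒< 0≤x = ≤-<-trans (≤-double 0≤x)

toℚᵘ-ℕ→ℚ : ∀ m → toℚᵘ (ℕ→ℚ m) ℚᵘ.≃ ℚᵘ.mkℚᵘ (+ m) 0
toℚᵘ-ℕ→ℚ m = toℚᵘ-fromℚᵘ (ℚᵘ.mkℚᵘ (+ m) 0)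

ℕ→ℚ-mono : ∀ {i j} → i ℕ.≤ j → ℕ→ℚ i ≤ ℕ→ℚ j
ℕ→ℚ-mono {i} {j} i≤j = toℚᵘ-cancel-≤
  (ℚᵘₚ.≤-respˡ-≃ (ℚᵘₚ.≃-sym (toℚᵘ-ℕ→ℚ i)) (ℚᵘₚ.≤-respʳ-≃ (ℚᵘₚ.≃-sym (toℚᵘ-ℕ→ℚ j))
    (ℚᵘ.*≤* (ℤₚ.*-monoʳ-≤-nonNeg (+ 1) (ℤ.+≤+ i≤j)))))

ℕ→ℚ-homo-+ : ∀ i j → ℕ→ℚ (i ℕ.+ j) ≡ ℕ→ℚ i + ℕ→ℚ j
ℕ→ℚ-homo-+ i j = toℚᵘ-injective (begin
  toℚᵘ (ℕ→ℚ (i ℕ.+ j))                        ≈⟨ toℚᵘ-ℕ→ℚ (i ℕ.+ j) ⟩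
  ℚᵘ.mkℚᵘ (+ (i ℕ.+ j)) 0                     ≈⟨ ℚᵘ.*≡* (cong (ℤ._* + 1) (cong₂ ℤ._+_ (sym (ℤₚ.*-identityʳ (+ i))) (sym (ℤₚ.*-identityʳ (+ j))))) ⟩
  ℚᵘ.mkℚᵘ (+ i) 0 ℚᵘ.+ ℚᵘ.mkℚᵘ (+ j) 0        ≈⟨ ℚᵘₚ.+-cong (toℚᵘ-ℕ→ℚ i) (toℚᵘ-ℕ→ℚ j) ⟨
  toℚᵘ (ℕ→ℚ i) ℚᵘ.+ toℚᵘ (ℕ→ℚ j)              ≈⟨ toℚᵘ-homo-+ (ℕ→ℚ i) (ℕ→ℚ j) ⟨
  toℚᵘ (ℕ→ℚ i + ℕ→ℚ j)                        ∎)
  where open import Relation.Binary.Reasoning.Setoid ℚᵘₚ.≃-setoid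

ℕ→ℚ-suc : ∀ m t → ℕ→ℚ (m ℕ.+ 1) * t ≡ ℕ→ℚ m * t + t
ℕ→ℚ-suc m t = trans (cong (_* t) (ℕ→ℚ-homo-+ m 1))
  (trans (*-distribʳ-+ t (ℕ→ℚ m) (ℕ→ℚ 1)) (cong (λ u → ℕ→ℚ m * t + u) (*-identityˡ t)))

2*≡double : ∀ t → ℕ→ℚ 2 * t ≡ t + t
2*≡double t = trans (ℕ→ℚ-suc 1 t) (cong (_+ t) (*-identityˡ t))

3*≡triple : ∀ t → ℕ→ℚ 3 * t ≡ triple t
3*≡triple t = trans (ℕ→ℚ-suc 2 t) (cong (_+ t) (2*≡double t))

greatest : ∀ {P : ℕ → Set} → (∀ m → Dec (P m)) → (∀ {i j} → i ℕ.≤ j → P j → P i) →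
  ∀ N → ¬ P N → ∃ λ s → (∀ m → P m → m ℕ.≤ s) × (P s ⊎ s ≡ 0)
greatest P? down zero ¬p = 0 , (λ m p → ⊥-elim (¬p (down z≤n p))) , inj₂ refl
greatest P? down (suc N) ¬p with P? N
... | no ¬pN = greatest P? down N ¬pN
... | yes pN = N , (λ m pm → ℕₚ.≮⇒≥ λ N<m → ¬p (down N<m pm)) , inj₁ pN

module _ (ι : ℕ → ℚ) (ι-mono : ∀ {i j} → i ℕ.≤ j → ι i ≤ ι j) (ι-+ : ∀ i j → ι (i ℕ.+ j) ≡ ι i + ι j) where

  ι-cancel-< : ∀ {i j} → ι i < ι j → i ℕ.< j
  ι-cancel-< i<j = ℕₚ.≰⇒> λ j≤i → <-irrefl refl (<-≤-trans i<j (ι-mono j≤i))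

  -- Counts are compared with a natural budget `s` instead of the rational tolerance `t`: the
  -- largest number embedded at or below `t`, or 0 if there is none.
  natural-threshold : ∀ {k} (size : Fin k → ℕ) → Fin k → (t : ℚ) →
    (∀ i → t + t < ι (size i)) → (∀ i → ι 3 < ι (size i)) →
    ∃ λ s → (∀ m → ι m ≤ t → m ℕ.≤ s) × (∀ i → s ℕ.+ s ℕ.< size i) × (∀ i → 4 ℕ.≤ size i)
  natural-threshold {k} size i₀ t 2t< 3< = s , bound , twice , (λ i → ι-cancel-< (3< i))
    where
    below : ∀ i m → ι m ≤ t → m ℕ.+ m ℕ.< size i
    below i m m≤t = ι-cancel-< (begin-strict
      ι (m ℕ.+ m)  ≡⟨ ι-+ m m ⟩
      ι m + ι m    ≤⟨ +-mono-≤ m≤t m≤t ⟩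
      t + t        <⟨ 2t< i ⟩
      ι (size i)   ∎)
      where open ≤-Reasoning
    threshold : ∃ λ s → (∀ m → ι m ≤ t → m ℕ.≤ s) × (ι s ≤ t ⊎ s ≡ 0)
    -- The search is bounded by `size i₀`: were it at most `t`, `below` would give
    -- `size i₀ + size i₀ < size i₀`.
    threshold = greatest (λ m → ι m ≤? t) (λ i≤j → ≤-trans (ι-mono i≤j)) (size i₀)
                  (λ le → ℕₚ.<⇒≱ (below i₀ (size i₀) le) (ℕₚ.m≤m+n _ _))
    s = proj₁ threshold
    bound = proj₁ (proj₂ threshold)
    twice : ∀ i → s ℕ.+ s ℕ.< size i
    twice i with proj₂ (proj₂ threshold)
    ... | inj₁ s≤t = below i s s≤t
    ... | inj₂ s≡0 = subst (λ u → u ℕ.+ u ℕ.< size i) (sym s≡0)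
                       (ℕₚ.≤-trans (s≤s z≤n) (ι-cancel-< (3< i)))

-- The two extreme perturbations

module Weights (r : ℚ) where

  -- Below r a distance is kept or tripled; from r on it is lifted to at least 3r,
  -- so that no set of centers can cost less than 3r.
  light heavy : ℚ → ℚ
  light t with t <? r
  ... | yes _ = t
  ... | no _  = t ⊔ triple r
  heavy t with t <? r
  ... | yes _ = triple t
  ... | no _  = t ⊔ triple r

  light≤heavy : ∀ {t u} → 0ℚ ≤ t → t ≤ u → light t ≤ heavy u
  light≤heavy {t} {u} 0≤t t≤u with t <? r | u <? r
  ... | yes _   | yes _   = ≤-trans t≤u (≤-triple (≤-trans 0≤t t≤u))
  ... | yes _   | no _    = ≤-trans t≤u (p≤p⊔q _ (triple r))
  ... | no t≮r  | yes u<r = ⊥-elim (t≮r (≤-<-trans t≤u u<r))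
  ... | no _    | no _    = ⊔-monoˡ-≤ _ t≤u

  ≤-heavy : ∀ {t} → 0ℚ ≤ t → t ≤ heavy t
  ≤-heavy {t} 0≤t with t <? r
  ... | yes _ = ≤-triple 0≤t
  ... | no _  = p≤p⊔q _ (triple r)

  ≤-light : ∀ {t} → t ≤ light t
  ≤-light {t} with t <? r
  ... | yes _ = ≤-refl
  ... | no _  = p≤p⊔q _ (triple r)

  light≤triple : ∀ {t} → 0ℚ ≤ t → light t ≤ triple t
  light≤triple {t} 0≤t with t <? r
  ... | yes _  = ≤-triple 0≤t
  ... | no t≮r = ⊔-lub (≤-triple 0≤t) (triple-mono (≮⇒≥ t≮r))

  heavy≤triple : ∀ {t} → 0ℚ ≤ t → heavy t ≤ triple t
  heavy≤triple {t} 0≤t with t <? r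
  ... | yes _  = ≤-refl
  ... | no t≮r = ⊔-lub (≤-triple 0≤t) (triple-mono (≮⇒≥ t≮r))

  triple-r≤light : ∀ {t} → r ≤ t → triple r ≤ light t
  triple-r≤light {t} r≤t with t <? r
  ... | yes t<r = ⊥-elim (<-irrefl refl (<-≤-trans t<r r≤t))
  ... | no _    = p≤q⊔p t (triple r)

  triple-r≤heavy : ∀ {t} → r ≤ t → triple r ≤ heavy t
  triple-r≤heavy {t} r≤t with t <? r
  ... | yes t<r = ⊥-elim (<-irrefl refl (<-≤-trans t<r r≤t))
  ... | no _    = p≤q⊔p t (triple r)

  light≤triple-r : ∀ {t} → t ≤ triple r → light t ≤ triple r
  light≤triple-r {t} t≤3r with t <? r
  ... | yes _ = t≤3r
  ... | no _  = ⊔-lub t≤3r ≤-refl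

  heavy≤triple-r : ∀ {t} → t ≤ triple r → heavy t ≤ triple r
  heavy≤triple-r {t} t≤3r with t <? r
  ... | yes t<r = triple-mono (<⇒≤ t<r)
  ... | no _    = ⊔-lub t≤3r ≤-refl

  heavy<light⇒< : ∀ {t u} → 0ℚ ≤ u → heavy t < light u → t < u
  heavy<light⇒< 0≤u h<l = ≰⇒> λ u≤t → <-irrefl refl (<-≤-trans h<l (light≤heavy 0≤u u≤t))

  -- A heavy weight is at least `3r` from `r` on, while `light u` stays within `3r`.
  heavy<light⇒<r : ∀ {t u} → u ≤ triple r → heavy t < light u → t < r
  heavy<light⇒<r u≤3r h<l = ≰⇒> λ r≤t →
    <-irrefl refl (<-≤-trans h<l (≤-trans (light≤triple-r u≤3r) (triple-r≤heavy r≤t)))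

  -- Below `r` nothing is lifted, so the handicap is a true factor 3; `t ≥ r` is excluded since it
  -- would give `r ≤ t ≤ heavy t < u < r`.
  heavy<light⇒triple< : ∀ {t u} → 0ℚ ≤ t → u < r → heavy t < light u → triple t < u
  heavy<light⇒triple< {t} {u} 0≤t u<r h<l with u <? r | t <? r
  ... | no u≮r | _      = ⊥-elim (u≮r u<r)
  ... | yes _  | yes _  = h<l
  ... | yes _  | no t≮r = ⊥-elim (t≮r (≤-<-trans (p≤p⊔q _ (triple r)) (<-trans h<l u<r)))

  weigh : ∀ {P : Set} → Dec P → ℚ → ℚ
  weigh (yes _) = heavy
  weigh (no _)  = light

-- The instance: centers, clusters and comparison under a handicap

module Instance
  {n k : ℕ} (d : Dist n) (metric : IsMetric d) (r : ℚ)
  (c : Centers n k) (opt : OptimalWithCost d c r)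
  (a : Clustering n k) (vor : IsVoronoi d (proj₁ c) a)
  (s : ℕ)
  (size>2s : ∀ i → s ℕ.+ s ℕ.< clusterSize a i)
  (size≥4 : ∀ i → 4 ℕ.≤ clusterSize a i)
  (resilient : ∀ d′ → (∀ p q → d p q ≤ d′ p q × d′ p q ≤ triple (d p q)) → ∀ c′ → Optimal d′ c′ →
     ∀ a′ → IsVoronoi d′ (proj₁ c′) a′ →
     ∃ λ (σ : Permutation′ k) → sum (map (λ i → diffSize a a′ i (σ ⟨$⟩ʳ i)) (allFin k)) ℕ.≤ s)
  where

  open IsMetric metric
  open Weights r

  ctr : Fin k → Fin n
  ctr = proj₁ c

  d-refl : ∀ p → d p p ≡ 0ℚ
  d-refl p = proj₂ (zero-iff p p) refl

  d-sym-≤ : ∀ {p q t} → d p q ≤ t → d q p ≤ t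
  d-sym-≤ {p} {q} = subst (_≤ _) (symm p q)

  -- The center assigned to `ctr i` is at distance 0 from it, hence equal to it, and the centers are
  -- distinct.
  a-ctr : ∀ i → a (ctr i) ≡ i
  a-ctr i = proj₂ c (proj₁ (zero-iff _ _) (≤-antisym
    (subst (d (ctr (a (ctr i))) (ctr i) ≤_) (d-refl (ctr i)) (vor (ctr i) i)) (nonneg _ _)))

  ctr-near : ∀ p → d (ctr (a p)) p ≤ r
  ctr-near p = let i , le = proj₁ (proj₁ opt) p in ≤-trans (vor p i) le

  -- `x` still serves `v` at a smaller perturbed distance than `y` when the handicap falls on `x`.
  Closer : Fin n → Fin n → Fin n → Set
  Closer x y v = heavy (d x v) < light (d y v)

  closer? : ∀ x y v → Dec (Closer x y v)
  closer? x y v = heavy (d x v) <? light (d y v)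

  closer⇒< : ∀ {x y v} → Closer x y v → d x v < d y v
  closer⇒< = heavy<light⇒< (nonneg _ _)

  closer-asym : ∀ {x y v} → Closer x y v → ¬ Closer y x v
  closer-asym p q = <-irrefl refl (<-trans (closer⇒< p) (closer⇒< q))

  closer-self : ∀ {x y} → ¬ Closer x y y
  closer-self {x} {y} cl = <-irrefl refl
    (<-≤-trans (closer⇒< cl) (subst (_≤ d x y) (sym (d-refl y)) (nonneg x y)))

  closer⇒<r : ∀ {x y v} → d y v ≤ triple r → Closer x y v → d x v < r
  closer⇒<r = heavy<light⇒<r

  ¬ctr-closer : ∀ {i j v} → a v ≡ j → ¬ Closer (ctr i) (ctr j) v
  ¬ctr-closer {i} {v = v} refl cl = <-irrefl refl (<-≤-trans (closer⇒< cl) (vor v i))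

  Good : (Fin k → Fin n) → Fin k → Fin n → Set
  Good z t v = ∀ j → j ≢ t → Closer (z t) (z j) v

  good? : ∀ z t v → Dec (Good z t v)
  good? z t v = all? λ j → ¬? (j ≟ t) →-dec closer? (z t) (z j) v

  Covers : (Fin k → Fin n) → Set
  Covers z = ∀ v → ∃ λ t → d (z t) v ≤ triple r

  module _ {G : Pred (Fin n) 0ℓ} (G? : Decidable G) (i : Fin k) where

    missing : ℕ
    missing = count λ v → (a v ≟ i) ×-dec ¬? (G? v)

  module _ {G H : Pred (Fin n) 0ℓ} (G? : Decidable G) (H? : Decidable H) where

    -- The two sets of exceptions have at most `2s` points together, fewer than the cluster.
    meet : ∀ i → missing G? i ℕ.≤ s → missing H? i ℕ.≤ s → ∃ λ v → a v ≡ i × G v × H v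
    meet i g h with any? (λ v → (a v ≟ i) ×-dec (G? v ×-dec H? v))
    ... | yes found = found
    ... | no none   = ⊥-elim (ℕₚ.<⇒≱ (size>2s i) (ℕₚ.≤-trans
      (count-⊎ (λ v → a v ≟ i) (λ v → (a v ≟ i) ×-dec ¬? (G? v)) (λ v → (a v ≟ i) ×-dec ¬? (H? v))
        split)
      (ℕₚ.+-mono-≤ g h)))
      where
      split : ∀ v → a v ≡ i → (a v ≡ i × ¬ G v) ⊎ (a v ≡ i × ¬ H v)
      split v av with G? v
      ... | no ¬g = inj₁ (av , ¬g)
      ... | yes g = inj₂ (av , λ h → none (v , av , g , h))

    missing-mono : ∀ i → (∀ v → a v ≡ i → H v → G v) → missing G? i ℕ.≤ missing H? i
    missing-mono i H⊆G = count-mono (λ v → (a v ≟ i) ×-dec ¬? (G? v)) (λ v → (a v ≟ i) ×-dec ¬? (H? v))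
      (λ v (av , ¬g) → av , λ h → ¬g (H⊆G v av h))

  other-member : ∀ i x → ∃ λ v → a v ≡ i × v ≢ x
  other-member i x with any? (λ v → (a v ≟ i) ×-dec ¬? (v ≟ x))
  ... | yes found = found
  ... | no none   = contradiction
    (ℕₚ.≤-trans (size≥4 i) (count-unique (λ v → a v ≟ i) x
      (λ v av → decidable-stable (v ≟ x) (λ v≢x → none (v , av , v≢x)))))
    λ { (s≤s ()) }

  -- Perturbations that handicap one center at each point

  module Handicap
    (z : Fin k → Fin n) (z-inj : Injective _≡_ _≡_ z) (covers : Covers z) (τ : Fin n → Fin k)
    where

    -- At `v` only the center `z (τ v)` is made heavy. This is not symmetric in the two arguments,
    -- which a perturbation need not be.
    d′ : Dist n
    d′ u v = weigh (u ≟ z (τ v)) (d u v)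

    private
      triple-bound : ∀ {P : Set} (w : Dec P) {t} → t ≤ triple r → weigh w t ≤ triple r
      triple-bound (yes _) = heavy≤triple-r
      triple-bound (no _)  = light≤triple-r

      far-bound : ∀ {P : Set} (w : Dec P) {t} → r ≤ t → triple r ≤ weigh w t
      far-bound (yes _) = triple-r≤heavy
      far-bound (no _)  = triple-r≤light

      between : ∀ {P : Set} (w : Dec P) {t} → 0ℚ ≤ t → (t ≤ weigh w t) × (weigh w t ≤ triple t)
      between (yes _) 0≤t = ≤-heavy 0≤t , heavy≤triple 0≤t
      between (no _)  0≤t = ≤-light , light≤triple 0≤t

    perturbation : ∀ p q → d p q ≤ d′ p q × d′ p q ≤ triple (d p q)
    perturbation p q = between (p ≟ z (τ q)) (nonneg p q)

    -- By optimality of `c` some point has distance at least `r` from all of `c′`, and such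
    -- distances are lifted to at least `3r`.
    costs-3r : ∀ (c′ : Centers n k) → CostAtLeast d′ (proj₁ c′) (triple r)
    costs-3r c′ = let p , far = proj₂ opt c′ in p , λ i → far-bound (proj₁ c′ i ≟ z (τ p)) (far i)

    -- Distances up to `3r` stay within `3r`, so the covering centers `z` attain the lower bound
    -- `costs-3r`.
    optimal : Optimal d′ (z , z-inj)
    optimal = triple r
      , ((λ p → let t , le = covers p in t , triple-bound (z t ≟ z (τ p)) le) , costs-3r (z , z-inj))
      , costs-3r

    d′-own : ∀ v → d′ (z (τ v)) v ≡ heavy (d (z (τ v)) v)
    d′-own v with z (τ v) ≟ z (τ v)
    ... | yes _ = refl
    ... | no ≢  = ⊥-elim (≢ refl)

    d′-other : ∀ v {j} → j ≢ τ v → d′ (z j) v ≡ light (d (z j) v)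
    d′-other v {j} j≢ with z j ≟ z (τ v)
    ... | yes e = ⊥-elim (j≢ (z-inj e))
    ... | no _  = refl

    abstract
      -- Ties are broken against the handicapped center z (τ v).
      assign : ∀ v → ∃ λ i → (∀ j → d′ (z i) v ≤ d′ (z j) v) × (i ≡ τ v → Good z (τ v) v) × (Good z (τ v) v → i ≡ τ v)
      assign v with good? z (τ v) v
      ... | yes g = τ v , closest , (λ _ → g) , (λ _ → refl)
        where
        closest : ∀ j → d′ (z (τ v)) v ≤ d′ (z j) v
        closest j with j ≟ τ v
        ... | yes refl = ≤-refl
        ... | no j≢ rewrite d′-own v | d′-other v j≢ = <⇒≤ (g j j≢)
      ... | no ¬g with argmin (τ v) (λ j → d′ (z j) v)
      ... | i , min with i ≟ τ v
      ... | no i≢ = i , min , (λ e → ⊥-elim (i≢ e)) , λ g → ⊥-elim (¬g g)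
      ... | yes refl with any? (λ j → ¬? (j ≟ τ v) ×-dec ¬? (closer? (z (τ v)) (z j) v))
      ... | yes (j , j≢ , ¬cl) = j , (λ l → ≤-trans tie (min l)) , (λ e → ⊥-elim (j≢ e)) , λ g → ⊥-elim (¬g g)
        where
        tie : d′ (z j) v ≤ d′ (z (τ v)) v
        tie rewrite d′-own v | d′-other v j≢ = ≮⇒≥ ¬cl
      ... | no none = ⊥-elim (¬g λ j j≢ →
        decidable-stable (closer? (z (τ v)) (z j) v) (λ ¬cl → none (j , j≢ , ¬cl)))

    a′ : Clustering n k
    a′ v = proj₁ (assign v)

    abstract
      matching : ∃ λ (σ : Permutation′ k) → sum (map (λ i → diffSize a a′ i (σ ⟨$⟩ʳ i)) (allFin k)) ℕ.≤ s
      matching = resilient d′ perturbation (z , z-inj) optimal a′ (λ v → proj₁ (proj₂ (assign v)))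

    σ : Permutation′ k
    σ = proj₁ matching

    matched? : ∀ i → Decidable (λ v → a′ v ≡ σ ⟨$⟩ʳ i)
    matched? i v = a′ v ≟ σ ⟨$⟩ʳ i

    missing-matched : ∀ i → missing (matched? i) i ℕ.≤ s
    missing-matched i = ℕₚ.≤-trans (≤-sum-map (λ i → diffSize a a′ i (σ ⟨$⟩ʳ i)) (∈-allFin i)) (proj₂ matching)

    a′≡τ⇒good : ∀ v → a′ v ≡ τ v → Good z (τ v) v
    a′≡τ⇒good v = proj₁ (proj₂ (proj₂ (assign v)))

    good⇒a′≡τ : ∀ v → Good z (τ v) v → a′ v ≡ τ v
    good⇒a′≡τ v = proj₂ (proj₂ (proj₂ (assign v)))

  miss : (Fin k → Fin n) → Fin k → Fin k → ℕ
  miss z t = missing (good? z t)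

  -- First each center in turn is handicapped everywhere: it still wins most of some cluster.
  -- Then every center is handicapped exactly on the cluster it wins.
  handicapped-matching : ∀ z → Injective _≡_ _≡_ z → Covers z →
    ∃ λ (σ : Permutation′ k) → sum (map (λ i → miss z (σ ⟨$⟩ʳ i) i) (allFin k)) ℕ.≤ s
  handicapped-matching z z-inj covers = final.σ , ℕₚ.≤-trans (sum-map-mono miss≤diff (allFin k)) (proj₂ final.matching)
    where
    module Each (t : Fin k) = Handicap z z-inj covers (λ _ → t)

    -- The cluster matched with `t` when `z t` is handicapped everywhere; `z t` then receives only
    -- points where it is good.
    won : Fin k → Fin k
    won t = Each.σ t ⟨$⟩ˡ t

    won-miss : ∀ t → miss z t (won t) ℕ.≤ s
    won-miss t = ℕₚ.≤-trans
      (missing-mono (good? z t) (Each.matched? t (won t)) (won t)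
        (λ v _ e → Each.a′≡τ⇒good t v (trans e (inverseʳ (Each.σ t)))))
      (Each.missing-matched t (won t))

    -- Two centers winning most of the same cluster would beat each other at a common point.
    won-inj : Injective _≡_ _≡_ won
    won-inj {t} {u} e = decidable-stable (t ≟ u) λ t≢u →
      let v , _ , g , h = meet (good? z t) (good? z u) (won t) (won-miss t)
                            (subst (λ i → miss z u i ℕ.≤ s) (sym e) (won-miss u))
      in closer-asym (g u (λ u≡t → t≢u (sym u≡t))) (h t t≢u)

    winner : Fin k → Fin k
    winner i = proj₁ (injective⇒surjective won won-inj i)

    winner-miss : ∀ i → miss z (winner i) i ℕ.≤ s
    winner-miss i = subst (λ j → miss z (winner i) j ℕ.≤ s) (proj₂ (injective⇒surjective won won-inj i)) (won-miss (winner i))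

    module final = Handicap z z-inj covers (λ v → winner (a v))

    -- Most points of cluster `i` are good for its winner and so assigned to it, and most are
    -- assigned to the label matched with `i`; a common point identifies the two.
    σ≡winner : ∀ i → final.σ ⟨$⟩ʳ i ≡ winner i
    σ≡winner i =
      let v , av , g , e = meet (good? z (winner i)) (final.matched? i) i (winner-miss i) (final.missing-matched i)
          e′ = final.good⇒a′≡τ v (subst (λ j → Good z (winner j) v) (sym av) g)
      in trans (sym e) (trans e′ (cong winner av))

    -- A point where the winner is not good is not assigned to it, so the single budget `s` of this
    -- last perturbation bounds all misses together.
    miss≤diff : ∀ i → miss z (final.σ ⟨$⟩ʳ i) i ℕ.≤ diffSize a final.a′ i (final.σ ⟨$⟩ʳ i)
    miss≤diff i = missing-mono (good? z (final.σ ⟨$⟩ʳ i)) (final.matched? i) i λ v av e →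
      let σ≡τ = trans (σ≡winner i) (cong winner (sym av))
      in subst (λ t → Good z t v) (sym σ≡τ) (final.a′≡τ⇒good v (trans e σ≡τ))

  -- Pairwise comparison of centers and chains of two comparisons

  lose : Fin n → Fin n → Fin k → ℕ
  lose x y = missing (closer? x y)

  lose-member : ∀ x {y i} → a y ≡ i → 1 ℕ.≤ lose x y i
  lose-member x {y} {i} ay = count-pos (λ v → (a v ≟ i) ×-dec ¬? (closer? x y v)) y (ay , closer-self)

  Beats₂ : Fin k → Fin n → Fin n → Fin n → Fin n → Set
  Beats₂ i x y z v = a v ≡ i × Closer x y v × Closer y z v

  beats₂? : ∀ i x y z → Decidable (Beats₂ i x y z)
  beats₂? i x y z v = (a v ≟ i) ×-dec (closer? x y v ×-dec closer? y z v)

  size≤lose : ∀ i x y z →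
    clusterSize a i ℕ.≤ lose x y i ℕ.+ (lose y z i ℕ.+ count (beats₂? i x y z))
  size≤lose i x y z = ℕₚ.≤-trans
    (count-⊎ (λ v → a v ≟ i) (λ v → (a v ≟ i) ×-dec ¬? (closer? x y v)) rest? split₁)
    (ℕₚ.+-monoʳ-≤ (lose x y i)
      (count-⊎ rest? (λ v → (a v ≟ i) ×-dec ¬? (closer? y z v)) (beats₂? i x y z) split₂))
    where
    rest? : Decidable (λ v → a v ≡ i × Closer x y v)
    rest? v = (a v ≟ i) ×-dec closer? x y v
    split₁ : ∀ v → a v ≡ i → (a v ≡ i × ¬ Closer x y v) ⊎ (a v ≡ i × Closer x y v)
    split₁ v av with closer? x y v
    ... | yes cl = inj₂ (av , cl)
    ... | no ¬cl = inj₁ (av , ¬cl)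
    split₂ : ∀ v → a v ≡ i × Closer x y v → (a v ≡ i × ¬ Closer y z v) ⊎ Beats₂ i x y z v
    split₂ v (av , cl) with closer? y z v
    ... | yes cl′ = inj₂ (av , cl , cl′)
    ... | no ¬cl′ = inj₁ (av , ¬cl′)

  -- As `y` is within `3r` of `v`, the first comparison gives `d x v < r`; only then is `z` known to
  -- be within `3r`, and the second gives `d y v < r`. Now the factor 3 is effective:
  -- `3 d x v < d y v ≤ d x y + d x v`.
  chain : ∀ {x y z v} → d y v ≤ triple r → (d x v ≤ r → d z v ≤ triple r) →
    Closer x y v → Closer y z v → d x v < r × d y v < r × d x v + d x v < d x y
  chain {x} {y} {z} {v} y-covers far cl₁ cl₂ = xv<r , yv<r
    , double-cancel (heavy<light⇒triple< (nonneg x v) yv<r cl₁)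
        (subst (λ t → d y v ≤ t + d x v) (symm y x) (triangle y x v))
    where
    xv<r = closer⇒<r y-covers cl₁
    yv<r = closer⇒<r (far (<⇒≤ xv<r)) cl₂

  -- Otherwise `3 d x y < d w y ≤ d x w + d x y`, so `d x y` is less than half of `d x w`, which is
  -- itself less than half of `d x y`.
  chain-end : ∀ {x y w} → d x w + d x w < d x y → d y w < r → ¬ Closer x w y
  chain-end {x} {y} {w} 2xw<xy yw<r cl = <-irrefl refl
    (<-trans (double<⇒< (nonneg x y) 2xy<xw) (double<⇒< (nonneg x w) 2xw<xy))
    where
    2xy<xw : d x y + d x y < d x w
    2xy<xw = double-cancel (heavy<light⇒triple< (nonneg x y) (subst (_< r) (symm y w) yw<r) cl)
               (subst (λ t → d w y ≤ t + d x y) (symm w x) (triangle w x y))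

  0≤r : Fin n → 0ℚ ≤ r
  0≤r v = ≤-trans (nonneg _ v) (ctr-near v)

  near-ctr : ∀ p → d p (ctr (a p)) ≤ r
  near-ctr p = d-sym-≤ (ctr-near p)

  path₂ : ∀ {p q v} → d p q ≤ r → d q v ≤ r → d p v ≤ triple r
  path₂ {p} {q} {v} pq qv = ≤-trans (triangle p q v) (≤-trans (+-mono-≤ pq qv) (double≤triple (0≤r v)))

  path₃ : ∀ {p q u v} → d p q ≤ r → d q u ≤ r → d u v ≤ r → d p v ≤ triple r
  path₃ {p} {q} {u} {v} pq qu uv =
    ≤-trans (triangle p u v) (+-mono-≤ (≤-trans (triangle p q u) (+-mono-≤ pq qu)) uv)

  same-cluster-covers : ∀ {p v} → a p ≡ a v → d p v ≤ triple r
  same-cluster-covers {p} {v} e = path₂ (near-ctr p) (subst (λ i → d (ctr i) v ≤ r) (sym e) (ctr-near v))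

  Matches : (Fin k → Fin n) → Permutation′ k → Set
  Matches z σ = ∀ i → miss z (σ ⟨$⟩ʳ i) i ℕ.≤ s

  matching-exists : ∀ z → Injective _≡_ _≡_ z → Covers z → ∃ λ σ →
    Matches z σ × (∀ {i j} → i ≢ j → miss z (σ ⟨$⟩ʳ i) i ℕ.+ miss z (σ ⟨$⟩ʳ j) j ℕ.≤ s)
  matching-exists z z-inj covers = let σ , total = handicapped-matching z z-inj covers in σ
    , (λ i → ℕₚ.≤-trans (≤-sum-map (λ i → miss z (σ ⟨$⟩ʳ i) i) (∈-allFin i)) total)
    , (λ {i} {j} i≢j → ℕₚ.≤-trans (+-≤-sum-map (λ i → miss z (σ ⟨$⟩ʳ i) i) i≢j (∈-allFin i) (∈-allFin j)) total)

  perm-injective : ∀ (σ : Permutation′ k) {i j} → σ ⟨$⟩ʳ i ≡ σ ⟨$⟩ʳ j → i ≡ j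
  perm-injective σ e = trans (sym (inverseˡ σ)) (trans (cong (σ ⟨$⟩ˡ_) e) (inverseˡ σ))

  lose≤miss : ∀ z {t u} i → u ≢ t → lose (z t) (z u) i ℕ.≤ miss z t i
  lose≤miss z {t} {u} i u≢t = missing-mono (closer? (z t) (z u)) (good? z t) i (λ _ _ g → g u u≢t)

  witness : ∀ {G : Pred (Fin n) 0ℓ} (G? : Decidable G) i → missing G? i ℕ.≤ s → ∃ λ v → a v ≡ i × G v
  witness G? i m≤s = let v , av , g , _ = meet G? G? i m≤s m≤s in v , av , g

  ctr-unbeaten : ∀ {t i} → ¬ lose (ctr t) (ctr i) i ℕ.≤ s
  ctr-unbeaten {t} {i} l≤s = let _ , av , cl = witness (closer? (ctr t) (ctr i)) i l≤s in ¬ctr-closer av cl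

  -- Exchange of the two clusters A and D, the others keeping their centers

  module Pair (A D : Fin k) (A≢D : A ≢ D) where

    U : Fin n → Set
    U v = a v ≡ A ⊎ a v ≡ D

    -- `x` wins `A` and `y` wins `D`, the exceptions in both clusters sharing one budget.
    Win : Fin n → Fin n → Set
    Win x y = lose x y A ℕ.+ lose y x D ℕ.≤ s

    -- The cluster sizes must exceed 3 because the two clusters may contribute
    -- two exceptional points in total.
    no-gap : ∀ {x y z z′} → U x → U y → Win x y → Win y z → Win z′ x →
      (∀ {v} → U v → d y v ≤ triple r) → (∀ {v} → U v → d x v ≤ triple r) →
      (∀ {v} → a v ≡ A → d x v ≤ r → d z v ≤ triple r) →
      (∀ {v} → a v ≡ D → d y v ≤ r → d z′ v ≤ triple r) →
      (∀ {v} → a x ≢ A ⊎ a y ≢ A → Beats₂ A x y z v → v ≡ x ⊎ v ≡ z′) →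
      (∀ {v} → a x ≢ D ⊎ a y ≢ D → Beats₂ D y x z′ v → v ≡ y ⊎ v ≡ z) → ⊥
    no-gap {x} {y} {z} {z′} ux uy xy yz z′x y-cov x-cov z-far z′-far excA excD = cases ux uy
      where
      yz≤s : lose y z A ℕ.≤ s
      yz≤s = ℕₚ.≤-trans (ℕₚ.m≤m+n _ _) yz
      xz′≤s : lose x z′ D ℕ.≤ s
      xz′≤s = ℕₚ.≤-trans (ℕₚ.m≤n+m _ _) z′x
      only : ∀ {u w v : Fin n} → a u ≢ a v → v ≡ u ⊎ v ≡ w → v ≡ w
      only u≢v (inj₁ refl) = ⊥-elim (u≢v refl)
      only u≢v (inj₂ e)    = e
      cases : U x → U y → ⊥
      -- `y` cannot beat `x` at `x` itself, a point of `D`. This loss pays for the exceptional point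
      -- of `A`, which can only be `z′` as `x` is not in `A`.
      cases (inj₂ xD) _ = one-sided (lose x y A) (lose y z A) (lose y x D) (count (beats₂? A x y z)) (size>2s A)
        (size≤lose A x y z) xy yz≤s (lose-member y xD)
        (count-unique (beats₂? A x y z) z′ λ v b →
          only (λ e → A≢D (trans (sym (proj₁ b)) (trans (sym e) xD)))
               (excA (inj₁ λ xA → A≢D (trans (sym xA) xD)) b))
      cases _ (inj₁ yA) = one-sided (lose y x D) (lose x z′ D) (lose x y A) (count (beats₂? D y x z′)) (size>2s D)
        (size≤lose D y x z′) (subst (ℕ._≤ s) (ℕₚ.+-comm (lose x y A) (lose y x D)) xy) xz′≤s (lose-member x yA)
        (count-unique (beats₂? D y x z′) z λ v b →
          only (λ e → A≢D (trans (sym yA) (trans e (proj₁ b))))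
               (excD (inj₂ λ yD → A≢D (trans (sym yA) yD)) b))
      cases (inj₁ xA) (inj₂ yD) = two-sided (lose x y A) (lose y x D) (lose y z A) (lose x z′ D)
          (count (at x)) (count (at z′)) (count (at′ y)) (count (at′ z))
          (size>2s A) (size>2s D) (size≥4 A) (size≥4 D) xy yz≤s xz′≤s
          (ℕₚ.≤-trans (size≤lose A x y z) (ℕₚ.+-monoʳ-≤ (lose x y A) (ℕₚ.+-monoʳ-≤ (lose y z A) E≤)))
          (ℕₚ.≤-trans (size≤lose D y x z′) (ℕₚ.+-monoʳ-≤ (lose y x D) (ℕₚ.+-monoʳ-≤ (lose x z′ D) F≤)))
          -- By `chain-end`, `x` exceptional in `A` excludes `z` exceptional in `D`, and likewise
          -- `z′` excludes `y`; so at most two of the four possible exceptions occur.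
          (count-exclusive (at x) (at′ z) x z (λ _ → proj₁) (λ _ → proj₁) λ
            { (refl , _ , _ , x-yz) (refl , zD , z-yx , z-xz′) →
              let _ , xz<r , 2yz<yx = chain {z = z′} (x-cov (inj₂ zD)) (z′-far zD) z-yx z-xz′
              in chain-end 2yz<yx xz<r x-yz })
          (count-exclusive (at z′) (at′ y) z′ y (λ _ → proj₁) (λ _ → proj₁) λ
            { (refl , z′A , z′-xy , z′-yz) (refl , _ , _ , y-xz′) →
              let _ , yz′<r , 2xz′<xy = chain {z = z} (y-cov (inj₁ z′A)) (z-far z′A) z′-xy z′-yz
              in chain-end 2xz′<xy yz′<r y-xz′ })
        where
        at : ∀ u → Decidable (λ v → v ≡ u × Beats₂ A x y z v)
        at u v = (v ≟ u) ×-dec beats₂? A x y z v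
        at′ : ∀ u → Decidable (λ v → v ≡ u × Beats₂ D y x z′ v)
        at′ u v = (v ≟ u) ×-dec beats₂? D y x z′ v
        E≤ : count (beats₂? A x y z) ℕ.≤ count (at x) ℕ.+ count (at z′)
        E≤ = count-⊎ (beats₂? A x y z) (at x) (at z′) λ v b →
          [ (λ e → inj₁ (e , b)) , (λ e → inj₂ (e , b)) ]′ (excA (inj₂ λ yA → A≢D (trans (sym yA) yD)) b)
        F≤ : count (beats₂? D y x z′) ℕ.≤ count (at′ y) ℕ.+ count (at′ z)
        F≤ = count-⊎ (beats₂? D y x z′) (at′ y) (at′ z) λ v b →
          [ (λ e → inj₁ (e , b)) , (λ e → inj₂ (e , b)) ]′ (excD (inj₁ λ xD → A≢D (trans (sym xA) xD)) b)

    module Exchange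
      (K Wₗ Wₕ : Fin n → Set)
      (K⊆U : ∀ {x} → K x → U x) (K⊆Wₗ : ∀ {x} → K x → Wₗ x) (K⊆Wₕ : ∀ {x} → K x → Wₕ x)
      (K-covers : ∀ {x v} → K x → U v → d x v ≤ triple r)
      (total : ∀ {x y} → K x → U y → x ≢ y → Win x y ⊎ Win y x)
      (near : ∀ {x y v} → K x → K y → U v → a x ≢ a v ⊎ a y ≢ a v → d x v ≤ r → d y v ≤ r → K v)
      (Wₗ-far : ∀ {x z v} → K x → Wₗ z → a v ≡ A → d x v ≤ r → d z v ≤ triple r)
      (Wₕ-far : ∀ {x z v} → K x → Wₕ z → a v ≡ D → d x v ≤ r → d z v ≤ triple r)
      where

      -- With `Win x y` read as `x` coming before `y`, `Low m` says that `m` is not last and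
      -- `High m` that it is not first.
      Low High : Fin n → Set
      Low m  = ∃ λ z → Wₗ z × Win m z
      High m = ∃ λ z → Wₕ z × Win z m

      low-unique : ∀ {u v} → K u → K v → ¬ Low u → ¬ Low v → u ≡ v
      low-unique {u} {v} ku kv ¬u ¬v = decidable-stable (u ≟ v) λ u≢v →
        [ (λ w → ¬u (v , K⊆Wₗ kv , w)) , (λ w → ¬v (u , K⊆Wₗ ku , w)) ]′ (total ku (K⊆U kv) u≢v)

      high-unique : ∀ {u v} → K u → K v → ¬ High u → ¬ High v → u ≡ v
      high-unique {u} {v} ku kv ¬u ¬v = decidable-stable (u ≟ v) λ u≢v →
        [ (λ w → ¬v (u , K⊆Wₕ ku , w)) , (λ w → ¬u (v , K⊆Wₕ kv , w)) ]′ (total ku (K⊆U kv) u≢v)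

      -- The witness after `m` can be chosen as the last point of `K`, if there is one. Since `Low`
      -- is undecidable, the choice is made in continuation form: the given witness is tried first,
      -- and a last point met on the way replaces it.
      lower : ∀ {m} → K m → Low m →
        (∀ {z} → Wₗ z → Win m z → (∀ {v} → K v → ¬ Low v → v ≡ z) → ⊥) → ⊥
      lower {m} km low@(z , wz , mz) found = found wz mz λ kv ¬lv → ⊥-elim (exceptional kv ¬lv)
        where
        exceptional : ∀ {v} → K v → ¬ Low v → ⊥
        exceptional {v} kv ¬lv with total km (K⊆U kv) (λ { refl → ¬lv low })
        ... | inj₁ mv = found (K⊆Wₗ kv) mv (λ ku ¬lu → low-unique ku kv ¬lu ¬lv)
        ... | inj₂ vm = ¬lv (m , K⊆Wₗ km , vm)

      -- Mirror image of `lower`, with the first point of `K`.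
      upper : ∀ {m} → K m → High m →
        (∀ {z} → Wₕ z → Win z m → (∀ {v} → K v → ¬ High v → v ≡ z) → ⊥) → ⊥
      upper {m} km high@(z , wz , zm) found = found wz zm λ kv ¬hv → ⊥-elim (exceptional kv ¬hv)
        where
        exceptional : ∀ {v} → K v → ¬ High v → ⊥
        exceptional {v} kv ¬hv with total km (K⊆U kv) (λ { refl → ¬hv high })
        ... | inj₁ mv = ¬hv (m , K⊆Wₕ km , mv)
        ... | inj₂ vm = found (K⊆Wₕ kv) vm (λ ku ¬hu → high-unique ku kv ¬hu ¬hv)

      Middle : Fin n → Set
      Middle m = K m × Low m × High m

      no-closest : ∀ {x y} → Middle x → Middle y → Win x y →
        (∀ {u v} → Middle u → Middle v → u ≢ v → d x y ≤ d u v) → ⊥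
      no-closest {x} {y} mx@(kx , _ , hx) my@(ky , ly , _) xy min =
        lower ky ly λ {z} wz yz z-only → upper kx hx λ {z′} wz′ z′x z′-only →
        let
          -- By the choice of `z` and `z′` no other point of `K` can be last or first, so `v` is a
          -- middle point and minimality applies to the pair `u`, `v`.
          clash : ∀ {u v} → Middle u → K v → v ≢ u → v ≢ z → v ≢ z′ → ¬ d u v < d x y
          clash mu kv v≢u v≢z v≢z′ uv<xy =
            (λ ¬lv → v≢z (z-only kv ¬lv)) λ lv →
            (λ ¬hv → v≢z′ (z′-only kv ¬hv)) λ hv →
            <-irrefl refl (<-≤-trans uv<xy (min mu (kv , lv , hv) λ u≡v → v≢u (sym u≡v)))
          excA : ∀ {v} → a x ≢ A ⊎ a y ≢ A → Beats₂ A x y z v → v ≡ x ⊎ v ≡ z′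
          excA {v} = λ { sep (refl , x-y , y-z) → one-of v x z′ λ v≢x v≢z′ →
            let xv<r , yv<r , 2xv<xy = chain {z = z} (K-covers ky (inj₁ refl)) (Wₗ-far kx wz refl) x-y y-z
            in clash mx (near kx ky (inj₁ refl) sep (<⇒≤ xv<r) (<⇒≤ yv<r)) v≢x
                 (λ { refl → closer-self y-z }) v≢z′ (double<⇒< (nonneg x v) 2xv<xy) }
          excD : ∀ {v} → a x ≢ D ⊎ a y ≢ D → Beats₂ D y x z′ v → v ≡ y ⊎ v ≡ z
          excD {v} = λ { sep (refl , y-x , x-z′) → one-of v y z λ v≢y v≢z →
            let yv<r , xv<r , 2yv<yx = chain {z = z′} (K-covers kx (inj₂ refl)) (Wₕ-far ky wz′ refl) y-x x-z′
            in clash my (near kx ky (inj₂ refl) sep (<⇒≤ xv<r) (<⇒≤ yv<r)) v≢y v≢z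
                 (λ { refl → closer-self x-z′ })
                 (subst (d y v <_) (symm y x) (double<⇒< (nonneg y v) 2yv<yx)) }
        in no-gap (K⊆U kx) (K⊆U ky) xy yz z′x (K-covers ky) (K-covers kx)
             (Wₗ-far kx wz) (Wₕ-far ky wz′) excA excD
        where
        one-of : ∀ (v p q : Fin n) → (v ≢ p → v ≢ q → ⊥) → v ≡ p ⊎ v ≡ q
        one-of v p q h with v ≟ p | v ≟ q
        ... | yes e | _     = inj₁ e
        ... | no _  | yes e = inj₂ e
        ... | no ≢p | no ≢q = ⊥-elim (h ≢p ≢q)

      -- Among the finitely many pairs of distinct middle points a closest one would exist, and
      -- `no-closest` refutes it in whichever order `Win` puts it.
      no-two : ∀ {x y} → x ≢ y → Middle x → ¬ Middle y
      no-two {x} {y} x≢y mx my = classical-minimum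
        (λ (u , v) → Middle u × Middle v × u ≢ v) (λ (u , v) → d u v)
        (cartesianProduct (allFin n) (allFin n))
        (λ { (u , v) _ (mu , mv , u≢v) min →
          let min′ : ∀ {u′ v′} → Middle u′ → Middle v′ → u′ ≢ v′ → d u v ≤ d u′ v′
              min′ {u′} {v′} mu′ mv′ ≢ = min (u′ , v′) (∈-cartesianProduct⁺ (∈-allFin u′) (∈-allFin v′)) (mu′ , mv′ , ≢)
          in [ (λ uv → no-closest mu mv uv min′)
             , (λ vu → no-closest mv mu vu (λ mu′ mv′ ≢ → d-sym-≤ (min′ mu′ mv′ ≢))) ]′
             (total (proj₁ mu) (K⊆U (proj₁ mv)) u≢v) })
        (x , y) (∈-cartesianProduct⁺ (∈-allFin x) (∈-allFin y)) (mx , my , x≢y)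

      -- At most one of the three is last, so two would be in the middle.
      no-three-high : ∀ {x y z} → K x → K y → K z → x ≢ y → x ≢ z → y ≢ z →
        High x → High y → ¬ High z
      no-three-high kx ky kz x≢y x≢z y≢z hx hy hz =
        two-of-three {K = λ u → K u × High u} {P = Low} (λ (ku , _) (kv , _) → low-unique ku kv)
          (kx , hx) (ky , hy) (kz , hz) x≢y x≢z y≢z
          λ (ku , hu) (kv , hv) u≢v lu lv → no-two u≢v (ku , lu , hu) (kv , lv , hv)

      -- At most one of the four is first, so three would be high.
      no-four : ∀ {w x y z} → K w → K x → K y → K z →
        w ≢ x → w ≢ y → w ≢ z → x ≢ y → x ≢ z → y ≢ z → ⊥
      no-four kw kx ky kz w≢x w≢y w≢z x≢y x≢z y≢z =
        three-of-four {K = K} {P = High} high-unique kw kx ky kz w≢x w≢y w≢z x≢y x≢z y≢z no-three-high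

    -- New centers for two clusters and the resulting matching

    label : ∀ t → t ≡ A ⊎ t ≡ D ⊎ (t ≢ A × t ≢ D)
    label t with t ≟ A | t ≟ D
    ... | yes e | _     = inj₁ e
    ... | no _  | yes e = inj₂ (inj₁ e)
    ... | no ≢A | no ≢D = inj₂ (inj₂ (≢A , ≢D))

    recenter : Fin n → Fin n → Fin k → Fin n
    recenter x y t = [ (λ _ → x) , [ (λ _ → y) , (λ _ → ctr t) ]′ ]′ (label t)

    module _ {x y : Fin n} where

      recenter-A : recenter x y A ≡ x
      recenter-A with label A
      ... | inj₁ _               = refl
      ... | inj₂ (inj₁ A≡D)      = ⊥-elim (A≢D A≡D)
      ... | inj₂ (inj₂ (≢A , _)) = ⊥-elim (≢A refl)

      recenter-D : recenter x y D ≡ y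
      recenter-D with label D
      ... | inj₁ D≡A             = ⊥-elim (A≢D (sym D≡A))
      ... | inj₂ (inj₁ _)        = refl
      ... | inj₂ (inj₂ (_ , ≢D)) = ⊥-elim (≢D refl)

      recenter-other : ∀ {t} → t ≢ A → t ≢ D → recenter x y t ≡ ctr t
      recenter-other {t} ≢A ≢D with label t
      ... | inj₁ e        = ⊥-elim (≢A e)
      ... | inj₂ (inj₁ e) = ⊥-elim (≢D e)
      ... | inj₂ (inj₂ _) = refl

    NoOtherCenter : Fin n → Set
    NoOtherCenter x = ∀ t → t ≢ A → t ≢ D → x ≢ ctr t

    U⇒no-other-center : ∀ {x} → U x → NoOtherCenter x
    U⇒no-other-center (inj₁ xA) t ≢A _ refl = ≢A (trans (sym (a-ctr t)) xA)
    U⇒no-other-center (inj₂ xD) t _ ≢D refl = ≢D (trans (sym (a-ctr t)) xD)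

    recenter-injective : ∀ {x y} → x ≢ y → NoOtherCenter x → NoOtherCenter y →
      Injective _≡_ _≡_ (recenter x y)
    recenter-injective x≢y nx ny {t} {u} e with label t | label u
    ... | inj₁ refl              | inj₁ refl              = refl
    ... | inj₁ _                 | inj₂ (inj₁ _)          = ⊥-elim (x≢y e)
    ... | inj₁ _                 | inj₂ (inj₂ (≢A , ≢D))  = ⊥-elim (nx u ≢A ≢D e)
    ... | inj₂ (inj₁ _)          | inj₁ _                 = ⊥-elim (x≢y (sym e))
    ... | inj₂ (inj₁ refl)       | inj₂ (inj₁ refl)       = refl
    ... | inj₂ (inj₁ _)          | inj₂ (inj₂ (≢A , ≢D))  = ⊥-elim (ny u ≢A ≢D e)
    ... | inj₂ (inj₂ (≢A , ≢D))  | inj₁ _                 = ⊥-elim (nx t ≢A ≢D (sym e))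
    ... | inj₂ (inj₂ (≢A , ≢D))  | inj₂ (inj₁ _)          = ⊥-elim (ny t ≢A ≢D (sym e))
    ... | inj₂ (inj₂ _)          | inj₂ (inj₂ _)          = proj₂ c e

    recenter-covers : ∀ {x y} → (∀ {v} → U v → d x v ≤ triple r ⊎ d y v ≤ triple r) → Covers (recenter x y)
    recenter-covers {x} {y} cov v = [ from-U ∘ inj₁ , [ from-U ∘ inj₂ , own ]′ ]′ (label (a v))
      where
      Served : Set
      Served = ∃ λ t → d (recenter x y t) v ≤ triple r
      own : a v ≢ A × a v ≢ D → Served
      own (≢A , ≢D) = a v , subst (λ u → d u v ≤ triple r) (sym (recenter-other ≢A ≢D))
                              (≤-trans (ctr-near v) (≤-triple (0≤r v)))
      from-U : U v → Served
      from-U uv = [ (λ le → A , subst (λ u → d u v ≤ triple r) (sym recenter-A) le)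
                  , (λ le → D , subst (λ u → d u v ≤ triple r) (sym recenter-D) le) ]′ (cov uv)

    module _ {x y : Fin n} {σ : Permutation′ k} (matches : Matches (recenter x y) σ) where

      matched-lose : ∀ i {t} u {w w′} → σ ⟨$⟩ʳ i ≡ t → u ≢ t →
        recenter x y t ≡ w → recenter x y u ≡ w′ → lose w w′ i ℕ.≤ s
      matched-lose i {t} u {w} {w′} σi≡t u≢t zt≡w zu≡w′ =
        subst (λ w → lose w w′ i ℕ.≤ s) zt≡w (subst (λ w′ → lose (recenter x y t) w′ i ℕ.≤ s) zu≡w′
          (ℕₚ.≤-trans (lose≤miss (recenter x y) {t} {u} i u≢t) (subst (λ t → miss (recenter x y) t i ℕ.≤ s) σi≡t (matches i))))

      -- On cluster `l` no old center beats `ctr l`, so only one of the two new points can take it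
      -- over.
      other-match : ∀ {l} → l ≢ A → l ≢ D →
        σ ⟨$⟩ʳ l ≡ l ⊎ (σ ⟨$⟩ʳ l ≡ A ⊎ σ ⟨$⟩ʳ l ≡ D)
      other-match {l} l≢A l≢D with label (σ ⟨$⟩ʳ l) | σ ⟨$⟩ʳ l ≟ l
      ... | inj₁ e               | _     = inj₂ (inj₁ e)
      ... | inj₂ (inj₁ e)        | _     = inj₂ (inj₂ e)
      ... | inj₂ (inj₂ _)        | yes e = inj₁ e
      ... | inj₂ (inj₂ (≢A , ≢D)) | no ≢l = ⊥-elim
        (ctr-unbeaten (matched-lose l l refl (λ e → ≢l (sym e)) (recenter-other ≢A ≢D) (recenter-other l≢A l≢D)))

      -- As `σ` fixes all other labels it permutes `A` and `D`, and each of its two possible forms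
      -- gives one order of `x` and `y`.
      matched-win : (∀ {i j} → i ≢ j →
          miss (recenter x y) (σ ⟨$⟩ʳ i) i ℕ.+ miss (recenter x y) (σ ⟨$⟩ʳ j) j ℕ.≤ s) →
        (∀ {l} → l ≢ A → l ≢ D → σ ⟨$⟩ʳ l ≡ l) → Win x y ⊎ Win y x
      matched-win sum≤s fixed = decide (label (σ ⟨$⟩ʳ A)) (label (σ ⟨$⟩ʳ D))
        where
        Same : Fin k → Fin k → Set
        Same t u = lose (recenter x y t) (recenter x y u) A ℕ.+ lose (recenter x y u) (recenter x y t) D ℕ.≤ s
        both : ∀ {t u} → σ ⟨$⟩ʳ A ≡ t → σ ⟨$⟩ʳ D ≡ u → t ≢ u → Same t u
        both {t} {u} σA σD t≢u = ℕₚ.≤-trans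
          (ℕₚ.+-mono-≤ (lose≤miss (recenter x y) {t} {u} A (λ e → t≢u (sym e)))
                        (lose≤miss (recenter x y) {u} {t} D t≢u))
          (subst₂ (λ t u → miss (recenter x y) t A ℕ.+ miss (recenter x y) u D ℕ.≤ s) σA σD (sum≤s A≢D))
        collide : ∀ {t} → σ ⟨$⟩ʳ A ≡ t → σ ⟨$⟩ʳ D ≡ t → ⊥
        collide σA σD = A≢D (perm-injective σ (trans σA (sym σD)))
        stuck : ∀ {i} → i ≡ A ⊎ i ≡ D → σ ⟨$⟩ʳ i ≢ A × σ ⟨$⟩ʳ i ≢ D → ⊥
        stuck {i} iU (≢A , ≢D) =
          let σi≡i = perm-injective σ (fixed ≢A ≢D)
          in [ (λ i≡A → ≢A (trans σi≡i i≡A)) , (λ i≡D → ≢D (trans σi≡i i≡D)) ]′ iU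
        decide : σ ⟨$⟩ʳ A ≡ A ⊎ σ ⟨$⟩ʳ A ≡ D ⊎ (σ ⟨$⟩ʳ A ≢ A × σ ⟨$⟩ʳ A ≢ D) →
          σ ⟨$⟩ʳ D ≡ A ⊎ σ ⟨$⟩ʳ D ≡ D ⊎ (σ ⟨$⟩ʳ D ≢ A × σ ⟨$⟩ʳ D ≢ D) → Win x y ⊎ Win y x
        decide (inj₁ AA)        (inj₁ DA)        = ⊥-elim (collide AA DA)
        decide (inj₁ AA)        (inj₂ (inj₁ DD)) = inj₁ (subst₂
          (λ u v → lose u v A ℕ.+ lose v u D ℕ.≤ s) recenter-A recenter-D (both AA DD A≢D))
        decide (inj₂ (inj₁ AD)) (inj₁ DA)        = inj₂ (subst₂
          (λ u v → lose u v A ℕ.+ lose v u D ℕ.≤ s) recenter-D recenter-A (both AD DA (λ e → A≢D (sym e))))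
        decide (inj₂ (inj₁ AD)) (inj₂ (inj₁ DD)) = ⊥-elim (collide AD DD)
        decide (inj₂ (inj₂ no-A)) _              = ⊥-elim (stuck (inj₁ refl) no-A)
        decide _ (inj₂ (inj₂ no-D))              = ⊥-elim (stuck (inj₂ refl) no-D)

    module _ {x y : Fin n} (ux : U x) (uy : U y) (x≢y : x ≢ y) (x-covers : ∀ {v} → U v → d x v ≤ triple r) where

      total-if-fixed : (∀ {σ} → Matches (recenter x y) σ → ∀ {l} → l ≢ A → l ≢ D → σ ⟨$⟩ʳ l ≡ l) →
        Win x y ⊎ Win y x
      total-if-fixed fixed =
        let σ , matches , sum≤s = matching-exists (recenter x y)
              (recenter-injective x≢y (U⇒no-other-center ux) (U⇒no-other-center uy))
              (recenter-covers λ uv → inj₁ (x-covers uv))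
        in matched-win {σ = σ} matches sum≤s (λ {l} → fixed {σ} matches {l})

      total-if-unbeaten :
        (∀ {u l} → U u → l ≢ A → l ≢ D → ¬ lose u (ctr l) l ℕ.≤ s) → Win x y ⊎ Win y x
      total-if-unbeaten unbeaten = total-if-fixed λ {σ} matches {l} l≢A l≢D →
        let l-keeps = recenter-other {x} {y} l≢A l≢D
        in [ id , [ (λ σl≡A → ⊥-elim (unbeaten ux l≢A l≢D
                      (matched-lose {σ = σ} matches l l σl≡A l≢A recenter-A l-keeps)))
                  , (λ σl≡D → ⊥-elim (unbeaten uy l≢A l≢D
                      (matched-lose {σ = σ} matches l l σl≡D l≢D recenter-D l-keeps))) ]′ ]′
           (other-match {σ = σ} matches l≢A l≢D)

      -- A center losing its cluster must win A or D, hence lies within r of it.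
      total-if-centers-apart :
        (∀ {l v} → l ≢ A → l ≢ D → U v → ¬ d (ctr l) v ≤ r) → Win x y ⊎ Win y x
      total-if-centers-apart apart = total-if-fixed λ {σ} matches {l} l≢A l≢D →
        let i = σ ⟨$⟩ˡ l
            σi≡l : σ ⟨$⟩ʳ i ≡ l
            σi≡l = inverseʳ σ
            wins-U : ∀ {j} → i ≡ j → (∀ {v} → a v ≡ j → U v) → ⊥
            wins-U {j} i≡j ⊆U =
              let v , av , cl = witness (closer? (ctr l) x) i
                    (matched-lose {σ = σ} matches i A σi≡l (λ e → l≢A (sym e)) (recenter-other l≢A l≢D) recenter-A)
                  uv = ⊆U (trans av i≡j)
              in apart l≢A l≢D uv (<⇒≤ (closer⇒<r (x-covers uv) cl))
        in [ (λ i≡A → ⊥-elim (wins-U i≡A inj₁))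
           , [ (λ i≡D → ⊥-elim (wins-U i≡D inj₂))
             , (λ (i≢A , i≢D) →
                 [ (λ σi≡i → trans (cong (σ ⟨$⟩ʳ_) (trans (sym σi≡l) σi≡i)) σi≡l)
                 , [ (λ σi≡A → ⊥-elim (l≢A (trans (sym σi≡l) σi≡A)))
                   , (λ σi≡D → ⊥-elim (l≢D (trans (sym σi≡l) σi≡D))) ]′ ]′ (other-match {σ = σ} matches i≢A i≢D))
             ]′ ]′ (label i)

    -- Border points: ends of threshold edges between the two clusters

    Border : Fin n → Set
    Border m = U m × ∃ λ w → U w × a w ≢ a m × d m w ≤ r

    two-labels : ∀ {p q w} → U p → U q → U w → a p ≢ a q → a w ≢ a q → a p ≡ a w
    two-labels (inj₁ p) _        (inj₁ w) _   _   = trans p (sym w)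
    two-labels (inj₂ p) _        (inj₂ w) _   _   = trans p (sym w)
    two-labels (inj₁ p) (inj₁ q) (inj₂ w) p≢q _   = ⊥-elim (p≢q (trans p (sym q)))
    two-labels (inj₁ p) (inj₂ q) (inj₂ w) _   w≢q = ⊥-elim (w≢q (trans w (sym q)))
    two-labels (inj₂ p) (inj₁ q) (inj₁ w) _   w≢q = ⊥-elim (w≢q (trans w (sym q)))
    two-labels (inj₂ p) (inj₂ q) (inj₁ w) p≢q _   = ⊥-elim (p≢q (trans p (sym q)))

    via-ctr : ∀ {p v} → a p ≡ a v → d p (ctr (a v)) ≤ r
    via-ctr {p} e = subst (λ i → d p (ctr i) ≤ r) e (near-ctr p)

    -- The own cluster is reached through its center, the other one through the neighbour `w` and
    -- then its center, in at most three steps of length `r`.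
    border-covers : ∀ {m v} → Border m → U v → d m v ≤ triple r
    border-covers {m} {v} (um , w , uw , w≢m , mw) uv with a m ≟ a v
    ... | yes e  = same-cluster-covers e
    ... | no m≢v = path₃ mw (via-ctr (sym (two-labels uv um uw (λ e → m≢v (sym e)) w≢m))) (ctr-near v)

    border-near : ∀ {x y v} → Border x → Border y → U v → a x ≢ a v ⊎ a y ≢ a v →
      d x v ≤ r → d y v ≤ r → Border v
    border-near {x} (ux , _) _ uv (inj₁ x≢v) xv _ = uv , x , ux , x≢v , d-sym-≤ xv
    border-near {y = y} _ (uy , _) uv (inj₂ y≢v) _ yv = uv , y , uy , y≢v , d-sym-≤ yv

    -- Starting from `ctr i`, the path goes to `x` directly or through the neighbour of `x` in
    -- cluster `i`, then on to `v`. This admits the old centers as witnesses.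
    border-hub : ∀ {i x v} → i ≡ A ⊎ i ≡ D → Border x → d x v ≤ r → d (ctr i) v ≤ triple r
    border-hub {i} {x} {v} iU (ux , w , uw , w≢x , xw) xv with a x ≟ i
    ... | yes refl = path₂ (ctr-near x) xv
    ... | no x≢i   = path₃
      (subst (λ j → d (ctr j) w ≤ r) w-label (ctr-near w)) (d-sym-≤ xw) xv
      where
      w-label : a w ≡ i
      w-label = trans (two-labels uw ux (subst (λ j → j ≡ A ⊎ j ≡ D) (sym (a-ctr i)) iU) w≢x
                        (λ e → x≢i (sym (trans (sym (a-ctr i)) e)))) (a-ctr i)

    U-ctr-A : U (ctr A)
    U-ctr-A = inj₁ (a-ctr A)

    U-ctr-D : U (ctr D)
    U-ctr-D = inj₂ (a-ctr D)

    Covering : Fin n → Set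
    Covering x = ∀ {v} → U v → d x v ≤ triple r

    -- Beating a point that covers within `3r` requires a distance below `r`.
    not-winning-A : ∀ {u m} → Covering m → (∀ {v} → a v ≡ A → ¬ d u v ≤ r) → ¬ Win u m
    not-winning-A {u} {m} cov far w =
      let v , av , cl = witness (closer? u m) A (ℕₚ.≤-trans (ℕₚ.m≤m+n _ _) w)
      in far av (<⇒≤ (closer⇒<r (cov (inj₁ av)) cl))

    not-winning-D : ∀ {u m} → Covering m → (∀ {v} → a v ≡ D → ¬ d u v ≤ r) → ¬ Win m u
    not-winning-D {u} {m} cov far w =
      let v , av , cl = witness (closer? u m) D (ℕₚ.≤-trans (ℕₚ.m≤n+m _ _) w)
      in far av (<⇒≤ (closer⇒<r (cov (inj₂ av)) cl))

    -- Contradictions from the order on border points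

    module Separate (total : ∀ {x y} → U x → U y → x ≢ y → Covering x → Win x y ⊎ Win y x) where

      border-total : ∀ {x y} → Border x → U y → x ≢ y → Win x y ⊎ Win y x
      border-total bx uy x≢y = total (proj₁ bx) uy x≢y (border-covers bx)

      -- Far from all of `D`, `ctr A` is no border point and cannot win `D`, so totality puts it
      -- before every border point.
      ctr-A-wins : (∀ {v} → a v ≡ D → ¬ d (ctr A) v ≤ r) → ∀ {m} → Border m → Win (ctr A) m
      ctr-A-wins far {m} bm@(um , w , uw , w≢m , mw) =
        [ ⊥-elim ∘ not-winning-D (border-covers bm) far , id ]′ (border-total bm U-ctr-A m≢ctr)
        where
        m≢ctr : m ≢ ctr A
        m≢ctr refl = far ([ (λ wA → ⊥-elim (w≢m (trans wA (sym (a-ctr A))))) , id ]′ uw) mw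

      ctr-D-loses : (∀ {v} → a v ≡ A → ¬ d (ctr D) v ≤ r) → ∀ {m} → Border m → Win m (ctr D)
      ctr-D-loses far {m} bm@(um , w , uw , w≢m , mw) =
        [ id , ⊥-elim ∘ not-winning-A (border-covers bm) far ]′ (border-total bm U-ctr-D m≢ctr)
        where
        m≢ctr : m ≢ ctr D
        m≢ctr refl = far ([ id , (λ wD → ⊥-elim (w≢m (trans wD (sym (a-ctr D))))) ]′ uw) mw

      or-ctr : Fin k → Fin n → Set
      or-ctr i z = Border z ⊎ z ≡ ctr i

      or-ctr-far : ∀ {i x z v} → i ≡ A ⊎ i ≡ D → Border x → or-ctr i z → U v → d x v ≤ r → d z v ≤ triple r
      or-ctr-far _  _  (inj₁ bz)   uv _  = border-covers bz uv
      or-ctr-far iU bx (inj₂ refl) _  xv = border-hub iU bx xv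

      -- The old centers `ctr A` and `ctr D` bound the order at its two ends, so all border points
      -- are in the middle, among them `p` and `q`.
      neither-ctr-near : ∀ {p q} → a p ≡ A → a q ≡ D → d p q ≤ r →
        (∀ {v} → a v ≡ D → ¬ d (ctr A) v ≤ r) → (∀ {v} → a v ≡ A → ¬ d (ctr D) v ≤ r) → ⊥
      neither-ctr-near {p} {q} pA qD pq A-far D-far = no-two p≢q (middle bp) (middle bq)
        where
        open Exchange Border (or-ctr D) (or-ctr A) proj₁ inj₁ inj₁ border-covers border-total border-near
          (λ bx wz vA → or-ctr-far (inj₂ refl) bx wz (inj₁ vA))
          (λ bx wz vD → or-ctr-far (inj₁ refl) bx wz (inj₂ vD))
        p≢q : p ≢ q
        p≢q refl = A≢D (trans (sym pA) qD)
        bp : Border p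
        bp = inj₁ pA , q , inj₂ qD , (λ e → A≢D (trans (sym pA) (trans (sym e) qD))) , pq
        bq : Border q
        bq = inj₂ qD , p , inj₁ pA , (λ e → A≢D (trans (sym pA) (trans e qD))) , d-sym-≤ pq
        middle : ∀ {m} → Border m → Middle m
        middle bm = bm , (ctr D , inj₂ refl , ctr-D-loses D-far bm) , (ctr A , inj₂ refl , ctr-A-wins A-far bm)

      -- The case of `ctr D` lying within `r` of a point of `A`

      module CtrDNear {v₀ : Fin n} (v₀A : a v₀ ≡ A) (Dv₀ : d (ctr D) v₀ ≤ r) where

        A≠D : ∀ {u v} → a u ≡ A → a v ≡ D → u ≢ v
        A≠D uA vD refl = A≢D (trans (sym uA) vD)

        from-ctr : ∀ {v i} → a v ≡ i → d (ctr i) v ≤ r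
        from-ctr {v} refl = ctr-near v

        to-ctr : ∀ {v i} → a v ≡ i → d v (ctr i) ≤ r
        to-ctr = d-sym-≤ ∘ from-ctr

        border-D : ∀ {u v} → a u ≡ D → a v ≡ A → d u v ≤ r → Border u
        border-D uD vA uv = inj₂ uD , _ , inj₁ vA , (λ e → A≢D (trans (sym vA) (trans e uD))) , uv

        border-A : ∀ {u v} → a u ≡ A → a v ≡ D → d u v ≤ r → Border u
        border-A uA vD uv = inj₁ uA , _ , inj₂ vD , (λ e → A≢D (trans (sym uA) (trans (sym e) vD))) , uv

        b-ctr-D : Border (ctr D)
        b-ctr-D = border-D (a-ctr D) v₀A Dv₀

        b-v₀ : Border v₀
        b-v₀ = border-A v₀A (a-ctr D) (d-sym-≤ Dv₀)

        v₀≢ctr-D : v₀ ≢ ctr D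
        v₀≢ctr-D = A≠D v₀A (a-ctr D)

        -- Through the two centers every point of `U` covers `U` within `3r`, so all of `U` is
        -- ordered, and each cluster supplies two of four points.
        centers-near : ¬ d (ctr A) (ctr D) ≤ r
        centers-near AD =
          let v , vA , v≢ = other-member A (ctr A)
              w , wD , w≢ = other-member D (ctr D)
          in no-four U-ctr-A (inj₁ vA) U-ctr-D (inj₂ wD)
               (λ e → v≢ (sym e)) (A≠D (a-ctr A) (a-ctr D)) (A≠D (a-ctr A) wD)
               (A≠D vA (a-ctr D)) (A≠D vA wD) (λ e → w≢ (sym e))
          where
          U-covers : ∀ {x v} → U x → U v → d x v ≤ triple r
          U-covers (inj₁ xA) (inj₁ vA) = same-cluster-covers (trans xA (sym vA))
          U-covers (inj₂ xD) (inj₂ vD) = same-cluster-covers (trans xD (sym vD))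
          U-covers (inj₁ xA) (inj₂ vD) = path₃ (to-ctr xA) AD (from-ctr vD)
          U-covers (inj₂ xD) (inj₁ vA) = path₃ (to-ctr xD) (d-sym-≤ AD) (from-ctr vA)
          open Exchange U U U id id id U-covers
            (λ ux uy x≢y → total ux uy x≢y (U-covers ux)) (λ _ _ uv _ _ _ → uv)
            (λ _ uz vA _ → U-covers uz (inj₁ vA)) (λ _ uz vD _ → U-covers uz (inj₂ vD))

        centers-far : ¬ d (ctr A) (ctr D) ≤ r → ⊥
        centers-far A≁D = ctr-A-far ctr-A-near
          where
          -- The two centers, `v₀` and `w` are four border points, distinct because the centers are
          -- more than `r` apart.
          ctr-A-near : ∀ {w} → a w ≡ D → ¬ d (ctr A) w ≤ r
          ctr-A-near {w} wD Aw = no-four (border-A (a-ctr A) wD Aw) b-v₀ b-ctr-D (border-D wD (a-ctr A) (d-sym-≤ Aw))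
            (λ { refl → A≁D (d-sym-≤ Dv₀) }) (A≠D (a-ctr A) (a-ctr D)) (A≠D (a-ctr A) wD)
            v₀≢ctr-D (A≠D v₀A wD) (λ { refl → A≁D Aw })
            where
            open Exchange Border Border Border proj₁ id id border-covers border-total border-near
              (λ _ bz vA _ → border-covers bz (inj₁ vA)) (λ _ bz vD _ → border-covers bz (inj₂ vD))

          ctr-A-far : (∀ {w} → a w ≡ D → ¬ d (ctr A) w ≤ r) → ⊥
          -- `ctr A` comes before all border points, so a third one besides `v₀` and `ctr D` would
          -- contradict `no-three-high`.
          ctr-A-far far = two-borders λ {m} bm m≢v₀ m≢D →
            no-three-high b-v₀ b-ctr-D bm v₀≢ctr-D (λ e → m≢v₀ (sym e)) (λ e → m≢D (sym e))
              (high b-v₀) (high b-ctr-D) (high bm)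
            where
            high : ∀ {m} → Border m → ∃ λ z → or-ctr A z × Win z m
            high bm = ctr A , inj₂ refl , ctr-A-wins far bm
            hub-A-far : ∀ {x z v} → Border x → or-ctr A z → a v ≡ D → d x v ≤ r → d z v ≤ triple r
            hub-A-far bx wz vD = or-ctr-far (inj₁ refl) bx wz (inj₂ vD)
            open Exchange Border Border (or-ctr A) proj₁ id inj₁ border-covers border-total border-near
              (λ _ bz vA _ → border-covers bz (inj₁ vA)) hub-A-far

            two-borders : (∀ {m} → Border m → m ≢ v₀ → ¬ m ≢ ctr D) → ⊥
            two-borders only = Two.no-two v₀≢ctr-D (middle b-v₀) (middle b-ctr-D)
              where
              member : ∀ {m} → Border m → m ≢ v₀ → m ≡ ctr D
              member {m} bm m≢v₀ = decidable-stable (m ≟ ctr D) (only bm m≢v₀)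
              U-far : ∀ {x z v} → Border x → U z → a v ≡ A → d x v ≤ r → d z v ≤ triple r
              U-far _ (inj₁ zA) vA _ = same-cluster-covers (trans zA (sym vA))
              -- Only `v₀` and `ctr D` are border points, so `x` is one of them and is reached from
              -- `z` through `ctr D`.
              U-far {x} bx (inj₂ zD) vA xv with x ≟ v₀
              ... | yes refl = path₃ (to-ctr zD) Dv₀ xv
              ... | no x≢v₀  = path₂ (to-ctr zD) (subst (λ u → d u _ ≤ r) (member bx x≢v₀) xv)
              module Two = Exchange Border U (or-ctr A) proj₁ proj₁ inj₁ border-covers border-total border-near
                U-far hub-A-far
              -- A second point of `D` is not a border point, so it cannot win `A` and comes after
              -- both border points, putting them in the middle.
              z = proj₁ (other-member D (ctr D))
              zD = proj₁ (proj₂ (other-member D (ctr D)))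
              z≢D = proj₂ (proj₂ (other-member D (ctr D)))
              z-far : ∀ {v} → a v ≡ A → ¬ d z v ≤ r
              z-far vA zv = z≢D (member (border-D zD vA zv) λ e → A≠D v₀A zD (sym e))
              low : ∀ {m} → Border m → m ≢ z → Two.Low m
              low bm m≢z = z , inj₂ zD ,
                [ id , ⊥-elim ∘ not-winning-A (border-covers bm) z-far ]′ (border-total bm (inj₂ zD) m≢z)
              middle : ∀ {m} → Border m → Two.Middle m
              middle {m} bm = bm , low bm m≢z , high bm
                where
                m≢z : m ≢ z
                m≢z with m ≟ v₀
                ... | yes refl = A≠D v₀A zD
                ... | no m≢v₀  = λ e → z≢D (trans (sym e) (member bm m≢v₀))

        impossible : ⊥
        impossible = centers-far centers-near

  -- No center lies within `r` of a point of another cluster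

  module CenterNear {l₀ : Fin k} {v₀ : Fin n} (l₀≢a : l₀ ≢ a v₀) (l₀v₀ : d (ctr l₀) v₀ ≤ r) where

    A : Fin k
    A = a v₀

    A≢l₀ : A ≢ l₀
    A≢l₀ e = l₀≢a (sym e)

    module P₀ = Pair A l₀ A≢l₀

    Outside : Fin n → Set
    Outside x = ∀ l → l ≢ A → x ≢ ctr l

    l₀-covers : ∀ {v} → P₀.U v → d (ctr l₀) v ≤ triple r
    l₀-covers {v} (inj₁ vA) = path₃ l₀v₀ (P₀.via-ctr (sym vA)) (ctr-near v)
    l₀-covers     (inj₂ vl) = same-cluster-covers (trans (a-ctr l₀) (sym vl))

    -- Only the center of `A` is replaced: `l₀` keeps its own, which covers both clusters, so `x`
    -- may lie anywhere.
    z : Fin n → Fin k → Fin n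
    z x = P₀.recenter x (ctr l₀)

    z-keeps : ∀ {x t} → t ≢ A → z x t ≡ ctr t
    z-keeps {x} {t} t≢A = from (t ≟ l₀)
      where
      from : Dec (t ≡ l₀) → z x t ≡ ctr t
      from (yes refl) = P₀.recenter-D
      from (no t≢l₀)  = P₀.recenter-other t≢A t≢l₀

    abstract
      z-matching : ∀ x → Outside x → ∃ λ σ → Matches (z x) σ
      z-matching x out =
        let σ , matches , _ = matching-exists (z x)
              (P₀.recenter-injective (out l₀ l₀≢a) (λ t t≢A _ → out t t≢A) (P₀.U⇒no-other-center P₀.U-ctr-D))
              (P₀.recenter-covers λ uv → inj₂ (l₀-covers uv))
        in σ , matches

    module _ (x : Fin n) (out : Outside x) where

      σ : Permutation′ k
      σ = proj₁ (z-matching x out)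

      z-lose : ∀ i {t} u {w w′} → σ ⟨$⟩ʳ i ≡ t → u ≢ t → z x t ≡ w → z x u ≡ w′ → lose w w′ i ℕ.≤ s
      z-lose = P₀.matched-lose {x} {ctr l₀} {σ} (proj₂ (z-matching x out))

      z-match : ∀ {l} → l ≢ A → σ ⟨$⟩ʳ l ≡ l ⊎ σ ⟨$⟩ʳ l ≡ A
      z-match {l} l≢A with σ ⟨$⟩ʳ l ≟ l | σ ⟨$⟩ʳ l ≟ A
      ... | yes e | _     = inj₁ e
      ... | no _  | yes e = inj₂ e
      ... | no ≢l | no ≢A = ⊥-elim (ctr-unbeaten (z-lose l l refl (λ e → ≢l (sym e)) (z-keeps ≢A) (z-keeps l≢A)))

      -- The cluster `i` won by `ctr l` is not `A` by hypothesis, and `z-match` then leaves only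
      -- `i ≡ l`.
      z-fixed : ∀ {D} → σ ⟨$⟩ʳ A ≡ A ⊎ σ ⟨$⟩ʳ A ≡ D → ∀ {l} → l ≢ A → l ≢ D → σ ⟨$⟩ʳ l ≡ l
      z-fixed {D} σA {l} l≢A l≢D = from (i ≟ A)
        where
        i = σ ⟨$⟩ˡ l
        σi≡l : σ ⟨$⟩ʳ i ≡ l
        σi≡l = inverseʳ σ
        from : Dec (i ≡ A) → σ ⟨$⟩ʳ l ≡ l
        from (yes i≡A) = ⊥-elim ([ (λ e → l≢A (trans (sym σA≡l) e)) , (λ e → l≢D (trans (sym σA≡l) e)) ]′ σA)
          where
          σA≡l : σ ⟨$⟩ʳ A ≡ l
          σA≡l = trans (cong (σ ⟨$⟩ʳ_) (sym i≡A)) σi≡l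
        from (no i≢A) = [ (λ σi≡i → trans (cong (σ ⟨$⟩ʳ_) (trans (sym σi≡l) σi≡i)) σi≡l)
                        , (λ σi≡A → ⊥-elim (l≢A (trans (sym σi≡l) σi≡A))) ]′ (z-match i≢A)

      guarded : ∀ {D} → σ ⟨$⟩ʳ A ≡ A ⊎ σ ⟨$⟩ʳ A ≡ D → ∀ {l} → l ≢ A → l ≢ D → lose (ctr l) x l ℕ.≤ s
      guarded σA {l} l≢A l≢D =
        z-lose l A (z-fixed σA l≢A l≢D) (λ e → l≢A (sym e)) (z-keeps l≢A) P₀.recenter-A

    -- By `guarded`, each center `ctr l` outside the pair beats every point of `A` or `D` other than
    -- `ctr D` on its own cluster. So none of these points can take it over, `A` and `D` are totally
    -- ordered, and `CtrDNear` applies.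
    separated : ∀ {D} → A ≢ D → ∀ {v} → a v ≡ A → d (ctr D) v ≤ r →
      (∀ x out → σ x out ⟨$⟩ʳ A ≡ A ⊎ σ x out ⟨$⟩ʳ A ≡ D) → ⊥
    separated {D} A≢D vA Dv σA = Separate.CtrDNear.impossible
        (λ ux uy x≢y x-covers → total-if-unbeaten ux uy x≢y x-covers unbeaten) vA Dv
      where
      open Pair A D A≢D
      outside : ∀ {u} → U u → u ≢ ctr D → Outside u
      outside uu u≢D l l≢A refl with l ≟ D
      ... | yes refl = u≢D refl
      ... | no l≢D   = U⇒no-other-center uu l l≢A l≢D refl
      unbeaten : ∀ {u l} → U u → l ≢ A → l ≢ D → ¬ lose u (ctr l) l ℕ.≤ s
      unbeaten {u} {l} uu l≢A l≢D beaten with u ≟ ctr D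
      ... | yes refl = ctr-unbeaten beaten
      ... | no u≢D   =
        let out = outside uu u≢D
            _ , _ , cl , cl′ = meet (closer? u (ctr l)) (closer? (ctr l) u) l beaten (guarded u out (σA u out) l≢A l≢D)
        in closer-asym cl cl′

    -- A center winning A from some x is the only one ever to do so, since any two would beat each other.
    not-stolen : ∀ x out → ¬ σ x out ⟨$⟩ʳ A ≢ A
    not-stolen x out D≢A = let v , vA , Dv = near (D ≟ l₀) in separated (λ e → D≢A (sym e)) vA Dv unique
      where
      D = σ x out ⟨$⟩ʳ A
      -- A center other than `ctr l₀` that wins `A` beats `ctr l₀` there, which covers `A` within
      -- `3r`; so it lies within `r` of a point of `A`.
      near : Dec (D ≡ l₀) → ∃ λ v → a v ≡ A × d (ctr D) v ≤ r
      near (yes D≡l₀) = v₀ , refl , subst (λ l → d (ctr l) v₀ ≤ r) (sym D≡l₀) l₀v₀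
      near (no D≢l₀)  =
        let v , vA , cl = witness (closer? (ctr D) (ctr l₀)) A
              (z-lose x out A l₀ refl (λ e → D≢l₀ (sym e)) (z-keeps D≢A) (z-keeps l₀≢a))
        in v , vA , <⇒≤ (closer⇒<r (l₀-covers (inj₁ vA)) cl)
      unique : ∀ y out′ → σ y out′ ⟨$⟩ʳ A ≡ A ⊎ σ y out′ ⟨$⟩ʳ A ≡ D
      unique y out′ with σ y out′ ⟨$⟩ʳ A ≟ A | σ y out′ ⟨$⟩ʳ A ≟ D
      ... | yes e | _     = inj₁ e
      ... | no _  | yes e = inj₂ e
      ... | no ≢A | no ≢D =
        let E = σ y out′ ⟨$⟩ʳ A
            _ , _ , cl , cl′ = meet (closer? (ctr D) (ctr E)) (closer? (ctr E) (ctr D)) A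
              (z-lose x out A E refl ≢D (z-keeps D≢A) (z-keeps ≢A))
              (z-lose y out′ A D refl (λ e → ≢D (sym e)) (z-keeps ≢A) (z-keeps D≢A))
        in ⊥-elim (closer-asym cl cl′)

    impossible : ⊥
    -- As `A` always goes to `x`, `l₀` can serve as the second cluster.
    impossible = separated A≢l₀ refl l₀v₀ λ x out →
      inj₁ (decidable-stable (σ x out ⟨$⟩ʳ A ≟ A) (not-stolen x out))

  -- Clusters and components of the threshold graph

  close⇒same-cluster : ∀ {p q} → d p q ≤ r → a p ≡ a q
  close⇒same-cluster {p} {q} pq = decidable-stable (a p ≟ a q) λ p≢q →
    let open Pair (a p) (a q) p≢q
        -- This gives both the totality of the order for the clusters of `p` and `q` and the two
        -- distance hypotheses of `neither-ctr-near`.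
        apart : ∀ {l v} → l ≢ a v → ¬ d (ctr l) v ≤ r
        apart l≢a lv = CenterNear.impossible l≢a lv
    in Separate.neither-ctr-near
         (λ ux uy x≢y x-covers → total-if-centers-apart ux uy x≢y x-covers
           λ l≢A l≢D → [ (λ vA → apart λ e → l≢A (trans e vA)) , (λ vD → apart λ e → l≢D (trans e vD)) ]′)
         refl refl pq
         (λ vD → apart λ e → p≢q (trans e vD)) (λ vA → apart λ e → p≢q (sym (trans e vA)))

  edge : ∀ {p q} → d p q ≤ r → SameComponent d r p q
  edge {p} {q} pq with p ≟ q
  ... | yes refl = Star.ε
  ... | no p≢q   = (p≢q , pq) ◅ Star.ε

  same-cluster⇔same-component : ∀ p q → (a p ≡ a q) ⇔ SameComponent d r p q
  same-cluster⇔same-component p q = mk⇔ connect same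
    where
    connect : a p ≡ a q → SameComponent d r p q
    connect e = edge (near-ctr p) ◅◅ edge (subst (λ i → d (ctr i) q ≤ r) (sym e) (ctr-near q))
    same : ∀ {p} → SameComponent d r p q → a p ≡ a q
    same Star.ε         = refl
    same ((_ , pq) ◅ c) = trans (close⇒same-cluster pq) (same c)

theorem4 : (n k : ℕ) (d : Dist n) → IsMetric d →
    (ε r* : ℚ) (c : Centers n k) → OptimalWithCost d c r* →
    (a : Clustering n k) → IsVoronoi d (proj₁ c) a →
    PerturbationResilient (ℕ→ℚ 3) ε d a →
    (∀ i → (ℕ→ℚ 2 * ε * ℕ→ℚ n < ℕ→ℚ (clusterSize a i)) × (ℕ→ℚ 3 < ℕ→ℚ (clusterSize a i))) →
    ∀ p q → (a p ≡ a q) ⇔ SameComponent d r* p q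
theorem4 n k d metric ε r* c opt a vor resilient large p q =
  let t = ε * ℕ→ℚ n
      s , bound , size>2s , size≥4 = natural-threshold ℕ→ℚ ℕ→ℚ-mono ℕ→ℚ-homo-+ (clusterSize a) (a p) t
        (λ i → subst (_< ℕ→ℚ (clusterSize a i))
                 (trans (*-assoc (ℕ→ℚ 2) ε (ℕ→ℚ n)) (2*≡double t)) (proj₁ (large i)))
        (λ i → proj₂ (large i))
  in Instance.same-cluster⇔same-component d metric r* c opt a vor s size>2s size≥4
       (λ d′ within c′ opt′ a′ vor′ →
         let σ , close = resilient d′
               (λ u v → proj₁ (within u v) , subst (d′ u v ≤_) (sym (3*≡triple (d u v))) (proj₂ (within u v)))
               c′ opt′ a′ vor′
         in σ , bound _ close)
       p q
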